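{- Let $(W,S)$ be a finitely generated Coxeter system (not necessarily finite) and $A\subseteq T$. Assume one of the following holds: (1) there exist subsets $S_1,S_2\subseteq S$ with $A=S_1\cup\bigl(\bigcup_{s\in S_2}C(s)\bigr)$, where $C(s)$ is the conjugacy class of $s$ in $W$; (2) $S=\{s,t\}$, the order $m(s,t)$ of $st$ is even or $\infty$, and $A=\{s,t,sts\}$ or $A=\{t,sts\}$. Then $A$ is nice.
   Context: $\ell$ is the length function, $T=\{wsw^{ -1}\mid w\in W,s\in S\}$ is the set of reflections. For $A\subseteq T$ and $w\in W$, $D_A(w)=\{r\in A\mid \ell(wr)<\ell(w)\}$. A subset $A\subseteq T$ is called nice if for every $r\in A$ and every $w\in W$ with $w^{ -1}rw\notin A$, one has $D_A(rw)=D_A(w)$. -}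

module Defs where

open import Data.Nat using (ℕ; _<_; _≤_; _*_)
open import Data.Fin using (Fin)
open import Data.Fin.Subset using (Subset; _∈_)
open import Data.List using (List; []; _∷_; _++_; reverse; length)
open import Data.Maybe using (Maybe; just; nothing)
open import Data.Product using (Σ; ∃; ∃-syntax; _×_; _,_)
open import Data.Sum using (_⊎_)
open import Relation.Binary.PropositionalEquality using (_≡_; _≢_)
open import Relation.Nullary using (¬_)
open import Function.Bundles using (_⇔_)

-- Coxeter matrices of finite rank n.  m i j = nothing encodes m(s,t) = ∞.

record CoxeterMatrix (n : ℕ) : Set where
  field
    m       : Fin n → Fin n → Maybe ℕ
    diag    : ∀ i → m i i ≡ just 1
    sym     : ∀ i j → m i j ≡ m j i
    offdiag : ∀ i j → i ≢ j → ∀ k → m i j ≡ just k → 2 ≤ k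
open CoxeterMatrix public

Word : ℕ → Set
Word n = List (Fin n)

alt : ∀ {n} → Fin n → Fin n → ℕ → Word n
alt s t ℕ.zero    = []
alt s t (ℕ.suc k) = s ∷ t ∷ alt s t k

-- The congruence on words generated by the Coxeter relations (st)^{m(s,t)} = 1
-- (for m(s,t) finite; m(s,s) = 1 gives s² = 1).  W = Word n / _~_.
data _~_ {n : ℕ} {M : CoxeterMatrix n} : Word n → Word n → Set where
  ~-refl  : ∀ {u} → _~_ {M = M} u u
  ~-sym   : ∀ {u v} → _~_ {M = M} u v → _~_ {M = M} v u
  ~-trans : ∀ {u v w} → _~_ {M = M} u v → _~_ {M = M} v w → _~_ {M = M} u w
  ~-cong  : ∀ {u u' v v'} → _~_ {M = M} u u' → _~_ {M = M} v v' →
            _~_ {M = M} (u ++ v) (u' ++ v')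
  ~-rel   : ∀ s t k → m M s t ≡ just k → _~_ {M = M} (alt s t k) []

Eq : ∀ {n} (M : CoxeterMatrix n) → Word n → Word n → Set
Eq M u v = _~_ {M = M} u v

-- ℓ(u) < ℓ(v), where ℓ is the length w.r.t. S (minimal length of a representing word).
LenLt : ∀ {n} (M : CoxeterMatrix n) → Word n → Word n → Set
LenLt M u v = ∃[ u' ] (Eq M u' u × (∀ v' → Eq M v' v → length u' < length v'))

-- Inverse of an element (generators are involutions)
inv : ∀ {n} → Word n → Word n
inv = reverse

-- Subsets of W (intended: subsets of T) as predicates on words.
Pred : ℕ → Set₁
Pred n = Word n → Set

InD : ∀ {n} (M : CoxeterMatrix n) → Pred n → Word n → Word n → Set
InD M A w r = A r × LenLt M (w ++ r) w

Nice : ∀ {n} (M : CoxeterMatrix n) → Pred n → Set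
Nice M A = ∀ r w → A r → ¬ A (inv w ++ r ++ w) →
           ∀ t → (InD M A (r ++ w) t ⇔ InD M A w t)

InC : ∀ {n} (M : CoxeterMatrix n) → Fin n → Word n → Set
InC M s u = ∃[ w ] Eq M u (w ++ s ∷ [] ++ inv w)

Cond1 : ∀ {n} (M : CoxeterMatrix n) → Pred n → Set
Cond1 {n} M A = Σ (Subset n) λ S₁ → Σ (Subset n) λ S₂ → (∀ u → A u ⇔
  ((∃[ s ] (s ∈ S₁ × Eq M u (s ∷ []))) ⊎ (∃[ s ] (s ∈ S₂ × InC M s u))))

Cond2 : ∀ {n} (M : CoxeterMatrix n) → Pred n → Set
Cond2 {n} M A = ∃[ s ] ∃[ t ] (s ≢ t × (∀ i → i ≡ s ⊎ i ≡ t)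
  × (m M s t ≡ nothing ⊎ ∃[ k ] m M s t ≡ just (2 * k))
  × ((∀ u → A u ⇔ (Eq M u (s ∷ []) ⊎ Eq M u (t ∷ []) ⊎ Eq M u (s ∷ t ∷ s ∷ [])))
     ⊎ (∀ u → A u ⇔ (Eq M u (t ∷ []) ⊎ Eq M u (s ∷ t ∷ s ∷ [])))))

{-# OPTIONS --safe #-}

-- For w ∈ W let N(w) be its set of right inversions. Since N(rw) = N(w) + w⁻¹N(r)w over 𝔽₂, a reflection t
-- can distinguish D_A(rw) from D_A(w) only if t ∈ w⁻¹N(r)w. When r is simple, N(r) = {r} and t would be
-- w⁻¹rw ∉ A; when r ranges over a whole conjugacy class, w⁻¹rw ∉ A is impossible. For r = sts in case (2),
-- N(r) = {s, r, ststs}: parity of the number of t's leaves only t = s, and then the centralizer of s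
-- forces w⁻¹rw ∈ {t, sts}.
--
-- Constructively the description of D_A needs a reduced word for w, that is, a solution of the word problem.
-- N(w) is therefore treated as a list of words modulo permutation and cancellation of equal pairs, which
-- gives the strong exchange condition with explicit witnesses, and Tits' argument decides equality in W
-- by induction on length. Its one external input, that st has order exactly m(s,t), comes from the
-- geometric representation, with scalars 2cos(π/m) realised as commuting operators on integer-valued
-- functions.
module Submission where

open import Defs
open import Algebra using (CommutativeMonoid)
open import Data.Bool using (Bool; true; false; _xor_)
import Data.Bool.Properties as 𝔹ₚ
open import Data.Empty using (⊥-elim)
open import Data.Fin using (Fin; zero; suc; toℕ; fromℕ<)
import Data.Fin.Properties as Finₚ
open import Data.List using (List; []; _∷_; [_]; _++_; length; map; applyDownFrom)
import Data.List.Properties as Lₚ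
open import Data.List.Relation.Binary.Pointwise using ([]; _∷_)
open import Data.List.Relation.Unary.Any using (here; there)
open import Data.Maybe using (Maybe; just; nothing; fromMaybe)
open import Data.Maybe.Properties using (just-injective)
open import Data.Nat as ℕ using (ℕ; zero; suc; s≤s; z≤n)
import Data.Nat.Divisibility as ℕ∣
import Data.Nat.Properties as ℕₚ
open import Data.Product using (∃-syntax; _×_; _,_; proj₁; proj₂)
open import Data.Sum as Sum using (_⊎_; inj₁; inj₂)
open import Function using (_∘_; id; const; case_of_)
open import Function.Bundles using (mk⇔; Equivalence)
open import Relation.Binary using (Setoid)
open import Relation.Binary.PropositionalEquality as ≡ using (_≡_; _≢_; _≗_; refl; cong; cong₂; subst)
open import Relation.Nullary using (¬_; Dec; yes; no; does; contradiction; map′; _×-dec_)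
open import Relation.Nullary.Decidable using (dec-true; dec-false)

-- All that the order of st requires of the scalar x = 2 cos θ is that sin (kθ) / sin θ, a monic
-- polynomial in x of degree k - 1, vanishes for k = m(s,t) and for no k with 0 < k < m(s,t). A
-- generic root, the class of x in ℤ[x] modulo the polynomial of index m(s,t), has this property by
-- degree alone, so neither real nor algebraic numbers occur. Such roots are needed for all matrix
-- entries at once. They act on functions on ℤᴮ, one coordinate for each possible entry, by f ↦ f(x
-- + 1) + f(x - 1) in that coordinate: operators in different coordinates commute because shifts do,
-- and equality is pointwise equality of integers. The price is that the polynomial relation holds
-- only on a submodule, so membership in it is carried through the whole representation.

inv-∷ : ∀ {n} (s : Fin n) w v → inv (s ∷ w) ++ v ≡ inv w ++ s ∷ v
inv-∷ s w v = ≡.trans (cong (_++ v) (Lₚ.unfold-reverse s w)) (Lₚ.++-assoc (inv w) [ s ] v)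

alt-snoc : ∀ {n} (s t : Fin n) k → alt s t k ++ [ s ] ≡ s ∷ alt t s k
alt-snoc s t zero = refl
alt-snoc s t (suc k) = cong (λ w → s ∷ t ∷ w) (alt-snoc s t k)

altFrom : ∀ {n} → Fin n → Fin n → ℕ → Word n
altFrom s t zero = []
altFrom s t (suc k) = s ∷ altFrom t s k

-- Turns the relator (st)ᵏ into the braid relation sts... = tst... with k letters on each side.
alt-altFrom : ∀ {n} (s t : Fin n) k → alt s t k ≡ altFrom s t k ++ inv (altFrom t s k)
alt-altFrom s t zero = refl
alt-altFrom s t (suc k) = cong (s ∷_) (begin
  t ∷ alt s t k                                        ≡⟨ alt-snoc t s k ⟨
  alt t s k ++ [ t ]                                   ≡⟨ cong (_++ [ t ]) (alt-altFrom t s k) ⟩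
  (altFrom t s k ++ inv (altFrom s t k)) ++ [ t ]      ≡⟨ Lₚ.++-assoc (altFrom t s k) _ _ ⟩
  altFrom t s k ++ inv (altFrom s t k) ++ [ t ]        ≡⟨ cong (altFrom t s k ++_) (Lₚ.unfold-reverse t (altFrom s t k)) ⟨
  altFrom t s k ++ inv (t ∷ altFrom s t k)             ∎)
  where
  open ≡.≡-Reasoning

-- Scalars 2 cos (π/m) as operators on integer-valued functions

module GeometricRepresentation where

  open import Data.Integer using (ℤ; +_; _+_; _*_; -_; _-_; 0ℤ; 1ℤ)
  import Data.Integer.Properties as ℤₚ
  open import Data.Integer.Divisibility.Signed using (_∣_; _∣?_; ∣m∣n⇒∣m+n; ∣m∣n⇒∣m-n; ∣-refl; ∣⇒∣ᵤ; divides)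
  open import Data.Integer.Tactic.RingSolver using (solve-∀)
  open import Data.Vec using (Vec; []; _∷_; updateAt; replicate)
  import Data.Vec.Properties as Vecₚ
  open ≡.≡-Reasoning

  record Linear {E : Set} (f : (E → ℤ) → (E → ℤ)) : Set where
    constructor linear
    field
      linear-cong : ∀ {h h'} → h ≗ h' → f h ≗ f h'
      linear-+    : ∀ h h' → f (λ e → h e + h' e) ≗ λ e → f h e + f h' e
      linear-neg  : ∀ h → f (λ e → - h e) ≗ λ e → - f h e

    linear-sub : ∀ h h' → f (λ e → h e - h' e) ≗ λ e → f h e - f h' e
    linear-sub h h' e = ≡.trans (linear-+ h (λ e → - h' e) e) (cong (λ z → f h e + z) (linear-neg h' e))

    linear-0 : ∀ {h} → h ≗ (λ _ → 0ℤ) → f h ≗ λ _ → 0ℤ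
    linear-0 {h} h0 e = begin
      f h e                   ≡⟨ linear-cong (λ e → ≡.trans (h0 e) (≡.sym (ℤₚ.+-inverseʳ (h e)))) e ⟩
      f (λ e → h e - h e) e   ≡⟨ linear-sub h h e ⟩
      f h e - f h e           ≡⟨ ℤₚ.+-inverseʳ (f h e) ⟩
      0ℤ                      ∎

  open Linear

  -- The Chebyshev polynomials sin(kθ)/sin θ in c = 2 cos θ.
  cheb : ∀ {E : Set} → ((E → ℤ) → (E → ℤ)) → ℕ → (E → ℤ) → (E → ℤ)
  cheb c zero h _ = 0ℤ
  cheb c (suc zero) h = h
  cheb c (suc (suc k)) h e = c (cheb c (suc k) h) e - cheb c k h e

  module _ {E : Set} {c : (E → ℤ) → (E → ℤ)} (lin : Linear c) where

    cheb-cong : ∀ k {h h'} → h ≗ h' → cheb c k h ≗ cheb c k h'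
    cheb-cong zero p e = refl
    cheb-cong (suc zero) p e = p e
    cheb-cong (suc (suc k)) p e = cong₂ _-_ (linear-cong lin (cheb-cong (suc k) p) e) (cheb-cong k p e)

    cheb-+ : ∀ k h h' → cheb c k (λ e → h e + h' e) ≗ λ e → cheb c k h e + cheb c k h' e
    cheb-+ zero h h' e = refl
    cheb-+ (suc zero) h h' e = refl
    cheb-+ (suc (suc k)) h h' e = ≡.trans
      (cong₂ _-_ (≡.trans (linear-cong lin (cheb-+ (suc k) h h') e) (linear-+ lin (cheb c (suc k) h) (cheb c (suc k) h') e)) (cheb-+ k h h' e))
      (lem (c (cheb c (suc k) h) e) (c (cheb c (suc k) h') e) (cheb c k h e) (cheb c k h' e))
      where
      lem : ∀ a b x y → (a + b) - (x + y) ≡ (a - x) + (b - y)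
      lem = solve-∀

    cheb-neg : ∀ k h → cheb c k (λ e → - h e) ≗ λ e → - cheb c k h e
    cheb-neg zero h e = refl
    cheb-neg (suc zero) h e = refl
    cheb-neg (suc (suc k)) h e = ≡.trans
      (cong₂ _-_ (≡.trans (linear-cong lin (cheb-neg (suc k) h) e) (linear-neg lin (cheb c (suc k) h) e)) (cheb-neg k h e))
      (lem (c (cheb c (suc k) h) e) (cheb c k h e))
      where
      lem : ∀ a x → (- a) - (- x) ≡ - (a - x)
      lem = solve-∀

    cheb-linear : ∀ k → Linear (cheb c k)
    cheb-linear k = linear (cheb-cong k) (cheb-+ k) (cheb-neg k)

    -- Hence a linear operator commuting with `c` preserves the kernel of each polynomial in `c`;
    -- this is how admissibility survives the scalars of the representation.
    cheb-comm : ∀ {f} → Linear f → (∀ h → c (f h) ≗ f (c h)) → ∀ k h → cheb c k (f h) ≗ f (cheb c k h)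
    cheb-comm lf comm zero h e = ≡.sym (linear-0 lf (λ _ → refl) e)
    cheb-comm lf comm (suc zero) h e = refl
    cheb-comm {f} lf comm (suc (suc k)) h e = begin
      c (cheb c (suc k) (f h)) e - cheb c k (f h) e
        ≡⟨ cong₂ _-_ (linear-cong lin (cheb-comm lf comm (suc k) h) e) (cheb-comm lf comm k h e) ⟩
      c (f (cheb c (suc k) h)) e - f (cheb c k h) e
        ≡⟨ cong (_- f (cheb c k h) e) (comm (cheb c (suc k) h) e) ⟩
      f (c (cheb c (suc k) h)) e - f (cheb c k h) e
        ≡⟨ linear-sub lf _ _ e ⟨
      f (cheb c (suc (suc k)) h) e ∎

    cheb-unique : ∀ (y : ℕ → E → ℤ) → (∀ e → y 0 e ≡ 0ℤ) →
      (∀ k e → y (suc (suc k)) e ≡ c (y (suc k)) e - y k e) →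
      ∀ k → y k ≗ cheb c k (y 1)
    cheb-unique y y0 y+ zero e = y0 e
    cheb-unique y y0 y+ (suc zero) e = refl
    cheb-unique y y0 y+ (suc (suc k)) e = ≡.trans (y+ k e)
      (cong₂ _-_ (linear-cong lin (cheb-unique y y0 y+ (suc k)) e) (cheb-unique y y0 y+ k e))

  double-linear : ∀ {E : Set} → Linear {E} (λ h e → h e + h e)
  double-linear = linear (λ p e → cong₂ _+_ (p e) (p e)) (λ h h' e → lem (h e) (h' e)) (λ h e → lem' (h e))
    where
    lem : ∀ a b → (a + b) + (a + b) ≡ (a + a) + (b + b)
    lem = solve-∀
    lem' : ∀ a → - a + - a ≡ - (a + a)
    lem' = solve-∀

  -- The limit θ = 0, where sin (kθ) / sin θ becomes k. It vanishes for no k > 0, so the scalar 2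
  -- gives st infinite order.
  cheb-double : ∀ {E : Set} k (h : E → ℤ) e → cheb (λ h e → h e + h e) k h e ≡ + k * h e
  cheb-double zero h e = refl
  cheb-double (suc zero) h e = ≡.sym (ℤₚ.*-identityˡ (h e))
  cheb-double (suc (suc k)) h e = ≡.trans
    (cong₂ (λ a b → (a + a) - b) (cheb-double (suc k) h e) (cheb-double k h e))
    (≡.trans (cong (λ a → (a * h e + a * h e) - + k * h e) (ℤₚ.pos-+ 1 k))
      (≡.trans (lem (+ k) (h e)) (cong (_* h e) (≡.sym (≡.trans (ℤₚ.pos-+ 1 (suc k)) (cong (λ z → 1ℤ + z) (ℤₚ.pos-+ 1 k)))))))
    where
    lem : ∀ k h → ((1ℤ + k) * h + (1ℤ + k) * h) - k * h ≡ (1ℤ + (1ℤ + k)) * h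
    lem = solve-∀

  -- The adjacency operator of the line in coordinate `i`; on x ↦ sin (θx) it would be
  -- multiplication by 2 cos θ.
  spread : ∀ {B} → Fin B → (Vec ℤ B → ℤ) → Vec ℤ B → ℤ
  spread i h e = h (updateAt e i (_+ 1ℤ)) + h (updateAt e i (_- 1ℤ))

  spread-linear : ∀ {B} (i : Fin B) → Linear (spread i)
  spread-linear i = linear (λ p e → cong₂ _+_ (p _) (p _)) (λ h h' e → lem (h _) (h' _) (h _) (h' _)) (λ h e → lem' (h _) (h _))
    where
    lem : ∀ a b x y → (a + b) + (x + y) ≡ (a + x) + (b + y)
    lem = solve-∀
    lem' : ∀ a x → - a + - x ≡ - (a + x)
    lem' = solve-∀

  spread-comm : ∀ {B} (i j : Fin B) h → spread i (spread j h) ≗ spread j (spread i h)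
  spread-comm i j h e with i Finₚ.≟ j
  ... | yes refl = refl
  ... | no i≢j = ≡.trans
    (cong₂ _+_ (cong₂ _+_ (sw (_+ 1ℤ) (_+ 1ℤ)) (sw (_- 1ℤ) (_+ 1ℤ)))
               (cong₂ _+_ (sw (_+ 1ℤ) (_- 1ℤ)) (sw (_- 1ℤ) (_- 1ℤ))))
    (lem (h _) (h _) (h _) (h _))
    where
    sw : ∀ f g → h (updateAt (updateAt e i g) j f) ≡ h (updateAt (updateAt e j f) i g)
    sw f g = cong h (Vecₚ.updateAt-commutes j i (i≢j ∘ ≡.sym) e)
    lem : ∀ a b x y → (a + b) + (x + y) ≡ (a + x) + (b + y)
    lem = solve-∀

  tensor : ∀ {B} → (Fin B → ℤ → ℤ) → Vec ℤ B → ℤ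
  tensor g [] = 1ℤ
  tensor g (x ∷ e) = g zero x * tensor (g ∘ suc) e

  -- One factor is left free because `spread i` acts on the factor at `i` alone.
  tensorAt : ∀ {B} → (Fin B → ℤ → ℤ) → Fin B → (ℤ → ℤ) → Vec ℤ B → ℤ
  tensorAt g zero a (x ∷ e) = a x * tensor (g ∘ suc) e
  tensorAt g (suc i) a (x ∷ e) = g zero x * tensorAt (g ∘ suc) i a e

  tensorAt-self : ∀ {B} g (i : Fin B) e → tensorAt g i (g i) e ≡ tensor g e
  tensorAt-self g zero (x ∷ e) = refl
  tensorAt-self g (suc i) (x ∷ e) = cong (g zero x *_) (tensorAt-self (g ∘ suc) i e)

  tensorAt-cong : ∀ {B} g (i : Fin B) {a b} → a ≗ b → tensorAt g i a ≗ tensorAt g i b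
  tensorAt-cong g zero p (x ∷ e) = cong (_* tensor (g ∘ suc) e) (p x)
  tensorAt-cong g (suc i) p (x ∷ e) = cong (g zero x *_) (tensorAt-cong (g ∘ suc) i p e)

  tensorAt-updateAt : ∀ {B} g (i : Fin B) a f e → tensorAt g i a (updateAt e i f) ≡ tensorAt g i (a ∘ f) e
  tensorAt-updateAt g zero a f (x ∷ e) = refl
  tensorAt-updateAt g (suc i) a f (x ∷ e) = cong (g zero x *_) (tensorAt-updateAt (g ∘ suc) i a f e)

  tensorAt-+ : ∀ {B} g (i : Fin B) a b e → tensorAt g i a e + tensorAt g i b e ≡ tensorAt g i (λ x → a x + b x) e
  tensorAt-+ g zero a b (x ∷ e) = ≡.sym (ℤₚ.*-distribʳ-+ (tensor (g ∘ suc) e) (a x) (b x))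
  tensorAt-+ g (suc i) a b (x ∷ e) = ≡.trans (≡.sym (ℤₚ.*-distribˡ-+ (g zero x) _ _))
    (cong (g zero x *_) (tensorAt-+ (g ∘ suc) i a b e))

  tensorAt-neg : ∀ {B} g (i : Fin B) a e → - tensorAt g i a e ≡ tensorAt g i (λ x → - a x) e
  tensorAt-neg g zero a (x ∷ e) = ℤₚ.neg-distribˡ-* (a x) (tensor (g ∘ suc) e)
  tensorAt-neg g (suc i) a (x ∷ e) = ≡.trans (ℤₚ.neg-distribʳ-* (g zero x) _)
    (cong (g zero x *_) (tensorAt-neg (g ∘ suc) i a e))

  tensor-ones : ∀ {B} (g : Fin B → ℤ → ℤ) → (∀ j → g j 1ℤ ≡ 1ℤ) → tensor g (replicate B 1ℤ) ≡ 1ℤ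
  tensor-ones {zero} g g1 = refl
  tensor-ones {suc B} g g1 = cong₂ _*_ (g1 zero) (tensor-ones (g ∘ suc) (g1 ∘ suc))

  tensorAt-ones : ∀ {B} g (i : Fin B) z → (∀ j → g j 1ℤ ≡ 1ℤ) → tensorAt g i (λ _ → z) (replicate B 1ℤ) ≡ z
  tensorAt-ones {suc B} g zero z g1 = ≡.trans (cong (z *_) (tensor-ones (g ∘ suc) (g1 ∘ suc))) (ℤₚ.*-identityʳ z)
  tensorAt-ones {suc B} g (suc i) z g1 = ≡.trans
    (cong₂ _*_ (g1 zero) (tensorAt-ones (g ∘ suc) i z (g1 ∘ suc))) (ℤₚ.*-identityˡ z)

  opaque
    comb : ℕ → ℤ → ℤ
    comb k x with (+ k + + k) ∣? x
    ... | yes _ = 1ℤ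
    ... | no  _ = 0ℤ

    comb-≡ : ∀ k {x y} → x ≡ y + (+ k + + k) → comb k x ≡ comb k y
    comb-≡ k {x} {y} p with (+ k + + k) ∣? x | (+ k + + k) ∣? y
    ... | yes _ | yes _ = refl
    ... | no  _ | no  _ = refl
    ... | yes d | no ¬d = contradiction (subst ((+ k + + k) ∣_) (≡.trans (cong (_- (+ k + + k)) p) (lem y (+ k))) (∣m∣n⇒∣m-n d ∣-refl)) ¬d
      where
      lem : ∀ y k → (y + (k + k)) - (k + k) ≡ y
      lem = solve-∀
    ... | no ¬d | yes d = contradiction (subst ((+ k + + k) ∣_) (≡.sym p) (∣m∣n⇒∣m+n d ∣-refl)) ¬d

    comb-0 : ∀ k → comb k 0ℤ ≡ 1ℤ
    comb-0 k with (+ k + + k) ∣? 0ℤ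
    ... | yes _ = refl
    ... | no ¬d = contradiction (divides 0ℤ refl) ¬d

    -- With 0 < d < k, the number 2d lies strictly between 0 and 2k.
    comb-double : ∀ k d → 0 ℕ.< d → d ℕ.< k → comb k (+ d + + d) ≡ 0ℤ
    comb-double k d 0<d d<k with (+ k + + k) ∣? (+ d + + d)
    ... | no _ = refl
    comb-double k (suc d) 0<d d<k | yes k∣d = contradiction (ℕ∣.∣⇒≤ (∣⇒∣ᵤ k∣d)) (ℕₚ.<⇒≱ (ℕₚ.+-mono-< d<k d<k))

  -- An odd function of period 2k, on which the polynomial of index j in the adjacency operator
  -- h ↦ h (x + 1) + h (x − 1) sends wave k 1 to wave k j; in particular index k annihilates it.
  wave : ℕ → ℕ → ℤ → ℤ
  wave k j x = comb k (x - + j) - comb k (x + + j)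

  wave-0 : ∀ k x → wave k 0 x ≡ 0ℤ
  wave-0 k x = ≡.trans (cong (λ y → comb k y - comb k (x + 0ℤ)) (lem x)) (ℤₚ.+-inverseʳ (comb k (x + 0ℤ)))
    where
    lem : ∀ x → x - 0ℤ ≡ x + 0ℤ
    lem = solve-∀

  -- The peaks at k and -k carry opposite signs and coincide modulo 2k.
  wave-period : ∀ k x → wave k k x ≡ 0ℤ
  wave-period k x = ≡.trans (cong (λ z → comb k (x - + k) - z) (comb-≡ k (lem x (+ k)))) (ℤₚ.+-inverseʳ (comb k (x - + k)))
    where
    lem : ∀ x k → x + k ≡ (x - k) + (k + k)
    lem = solve-∀

  wave-diagonal : ∀ k d → 0 ℕ.< d → d ℕ.< k → wave k d (+ d) ≡ 1ℤ
  wave-diagonal k d 0<d d<k = cong₂ _-_ (≡.trans (cong (comb k) (ℤₚ.+-inverseʳ (+ d))) (comb-0 k)) (comb-double k d 0<d d<k)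

  -- The peaks at ±(j + 1), moved by one both ways, land at ±j and ±(j + 2). Thus `wave k` obeys the
  -- Chebyshev recurrence in its index.
  wave-step : ∀ k j x → (wave k (suc j) (x + 1ℤ) + wave k (suc j) (x - 1ℤ)) - wave k j x ≡ wave k (suc (suc j)) x
  wave-step k j x = ≡.trans
    (cong (λ z → z - wave k j x) (cong₂ _+_
      (cong₂ (λ a b → comb k a - comb k b) (l₁ x (+ j)) (l₂ x (+ j)))
      (cong₂ (λ a b → comb k a - comb k b) (l₃ x (+ j)) (l₄ x (+ j)))))
    (lem (comb k (x - + j)) (comb k (x + (1ℤ + (1ℤ + + j)))) (comb k (x - (1ℤ + (1ℤ + + j)))) (comb k (x + + j)))
    where
    l₁ : ∀ x j → (x + 1ℤ) - (1ℤ + j) ≡ x - j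
    l₁ = solve-∀
    l₂ : ∀ x j → (x + 1ℤ) + (1ℤ + j) ≡ x + (1ℤ + (1ℤ + j))
    l₂ = solve-∀
    l₃ : ∀ x j → (x - 1ℤ) - (1ℤ + j) ≡ x - (1ℤ + (1ℤ + j))
    l₃ = solve-∀
    l₄ : ∀ x j → (x - 1ℤ) + (1ℤ + j) ≡ x + j
    l₄ = solve-∀
    lem : ∀ a b c d → ((a - b) + (c - d)) - (a - d) ≡ c - b
    lem = solve-∀

  -- Tensor factors are indexed by the possible finite entries 2, 3, … off the diagonal.
  order : ∀ {B} → Fin B → ℕ
  order i = suc (suc (toℕ i))

  wave₁ : ∀ {B} → Fin B → ℤ → ℤ
  wave₁ i = wave (order i) 1

  -- A single function tests all finite entries at once: each entry acts on its own factor, and the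
  -- other factors take the value 1 at 1.
  testFunction : ∀ {B} → Vec ℤ B → ℤ
  testFunction = tensor wave₁

  cheb-testFunction : ∀ {B} (i : Fin B) k e →
    cheb (spread i) k testFunction e ≡ tensorAt wave₁ i (wave (order i) k) e
  cheb-testFunction i zero e = ≡.sym (≡.trans (tensorAt-cong wave₁ i (wave-0 (order i)) e) (tensorAt-0 _ i e))
    where
    tensorAt-0 : ∀ {B} g (i : Fin B) e → tensorAt g i (λ _ → 0ℤ) e ≡ 0ℤ
    tensorAt-0 g zero (x ∷ e) = refl
    tensorAt-0 g (suc i) (x ∷ e) = ≡.trans (cong (g zero x *_) (tensorAt-0 (g ∘ suc) i e)) (ℤₚ.*-zeroʳ (g zero x))
  cheb-testFunction i (suc zero) e = ≡.sym (tensorAt-self wave₁ i e)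
  cheb-testFunction i (suc (suc k)) e = begin
    spread i (cheb (spread i) (suc k) testFunction) e - cheb (spread i) k testFunction e
      ≡⟨ cong₂ _-_ (linear-cong (spread-linear i) (cheb-testFunction i (suc k)) e) (cheb-testFunction i k e) ⟩
    (T w (updateAt e i (_+ 1ℤ)) + T w (updateAt e i (_- 1ℤ))) - T w' e
      ≡⟨ cong (_- T w' e) (cong₂ _+_ (tensorAt-updateAt wave₁ i w _ e) (tensorAt-updateAt wave₁ i w _ e)) ⟩
    (T (w ∘ (_+ 1ℤ)) e + T (w ∘ (_- 1ℤ)) e) - T w' e
      ≡⟨ cong₂ _+_ (tensorAt-+ wave₁ i _ _ e) (tensorAt-neg wave₁ i w' e) ⟩
    T (λ x → w (x + 1ℤ) + w (x - 1ℤ)) e + T (λ x → - w' x) e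
      ≡⟨ tensorAt-+ wave₁ i _ _ e ⟩
    T (λ x → (w (x + 1ℤ) + w (x - 1ℤ)) - w' x) e
      ≡⟨ tensorAt-cong wave₁ i (wave-step (order i) k) e ⟩
    T (wave (order i) (suc (suc k))) e ∎
    where
    T = tensorAt wave₁ i
    w = wave (order i) (suc k)
    w' = wave (order i) k

  wave₁-1 : ∀ {B} (i : Fin B) → wave₁ i 1ℤ ≡ 1ℤ
  wave₁-1 i = wave-diagonal (order i) 1 (s≤s z≤n) (s≤s (s≤s z≤n))

  cheb-testFunction-≢0 : ∀ {B} (i : Fin B) d → 0 ℕ.< d → d ℕ.< order i →
    ∃[ e ] cheb (spread i) d testFunction e ≡ 1ℤ
  -- Coordinate `i` is placed at the peak d of `wave (order i) d`, all others at the peak 1 of their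
  -- factors.
  cheb-testFunction-≢0 {B} i d 0<d d<k = updateAt (replicate B 1ℤ) i (const (+ d)) , (begin
    cheb (spread i) d testFunction _                              ≡⟨ cheb-testFunction i d _ ⟩
    tensorAt wave₁ i (wave (order i) d) _                         ≡⟨ tensorAt-updateAt wave₁ i _ _ (replicate B 1ℤ) ⟩
    tensorAt wave₁ i (λ _ → wave (order i) d (+ d)) _             ≡⟨ tensorAt-ones wave₁ i _ wave₁-1 ⟩
    wave (order i) d (+ d)                                        ≡⟨ wave-diagonal (order i) d 0<d d<k ⟩
    1ℤ                                                            ∎)

  cheb-order-testFunction : ∀ {B} (i : Fin B) e → cheb (spread i) (order i) testFunction e ≡ 0ℤ
  cheb-order-testFunction i e = begin
    cheb (spread i) (order i) testFunction e           ≡⟨ cheb-testFunction i (order i) e ⟩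
    tensorAt wave₁ i (wave (order i) (order i)) e      ≡⟨ tensorAt-cong wave₁ i (λ x → ≡.trans (wave-period (order i) x) (≡.sym (wave-0 (order i) x))) e ⟩
    tensorAt wave₁ i (wave (order i) 0) e              ≡⟨ cheb-testFunction i 0 e ⟨
    0ℤ                                                 ∎

  testFunction-ones : ∀ {B} → testFunction (replicate B 1ℤ) ≡ 1ℤ
  testFunction-ones {B} = tensor-ones {B} wave₁ wave₁-1

  -- Finite sums and the scalar of a matrix entry

  ∑ : ∀ {n} → (Fin n → ℤ) → ℤ
  ∑ {zero} f = 0ℤ
  ∑ {suc n} f = f zero + ∑ (f ∘ suc)

  ∑-cong : ∀ {n} {f g : Fin n → ℤ} → f ≗ g → ∑ f ≡ ∑ g
  ∑-cong {zero} p = refl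
  ∑-cong {suc n} p = cong₂ _+_ (p zero) (∑-cong (p ∘ suc))

  ∑-0 : ∀ {n} {f : Fin n → ℤ} → (∀ i → f i ≡ 0ℤ) → ∑ f ≡ 0ℤ
  ∑-0 {zero} p = refl
  ∑-0 {suc n} p = cong₂ _+_ (p zero) (∑-0 (p ∘ suc))

  ∑-update : ∀ {n} (f g : Fin n → ℤ) i → (∀ j → j ≢ i → g j ≡ f j) → ∑ g ≡ ∑ f + (g i - f i)
  ∑-update {suc n} f g zero p = ≡.trans
    (cong (λ z → g zero + z) (∑-cong (λ j → p (suc j) (λ ()))))
    (lem (f zero) (g zero) (∑ (f ∘ suc)))
    where
    lem : ∀ a b x → b + x ≡ (a + x) + (b - a)
    lem = solve-∀
  ∑-update {suc n} f g (suc i) p = ≡.trans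
    (cong₂ _+_ (p zero (λ ())) (∑-update (f ∘ suc) (g ∘ suc) i (λ j j≢i → p (suc j) (j≢i ∘ Finₚ.suc-injective))))
    (≡.sym (ℤₚ.+-assoc (f zero) (∑ (f ∘ suc)) _))

  -- Multiplication by 2 cos (π / k) for a matrix entry k, with 2 cos (π / 1) = −2 and 2 cos 0 = 2 for k = ∞.
  cosOp : ∀ {B} → Maybe ℕ → (Vec ℤ B → ℤ) → Vec ℤ B → ℤ
  cosOp nothing h e = h e + h e
  -- A default: matrix entries are 1 on the diagonal and at least 2 off it.
  cosOp (just 0) h e = 0ℤ
  cosOp (just 1) h e = - (h e + h e)
  cosOp {B} (just (suc (suc k))) with k ℕ.<? B
  ... | yes k<B = spread (fromℕ< k<B)
  -- Again a default: B is chosen so that every finite entry lies below B + 2.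
  ... | no _ = λ _ _ → 0ℤ

  zero-linear : ∀ {E : Set} → Linear {E} (λ _ _ → 0ℤ)
  zero-linear = linear (λ _ _ → refl) (λ _ _ _ → refl) (λ _ _ → refl)

  cosOp-linear : ∀ {B} μ → Linear (cosOp {B} μ)
  cosOp-linear nothing = double-linear
  cosOp-linear (just 0) = zero-linear
  cosOp-linear (just 1) = linear (λ p e → cong -_ (linear-cong double-linear p e))
    (λ h h' e → ≡.trans (cong -_ (linear-+ double-linear h h' e)) (ℤₚ.neg-distrib-+ (h e + h e) (h' e + h' e)))
    (λ h e → cong -_ (linear-neg double-linear h e))
  cosOp-linear {B} (just (suc (suc k))) with k ℕ.<? B
  ... | yes k<B = spread-linear (fromℕ< k<B)
  ... | no _ = zero-linear

  spread-cosOp : ∀ {B} (i : Fin B) μ h → spread i (cosOp μ h) ≗ cosOp μ (spread i h)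
  spread-cosOp i nothing h e = linear-+ (spread-linear i) h h e
  spread-cosOp i (just 0) h e = refl
  spread-cosOp i (just 1) h e = ≡.trans (linear-neg (spread-linear i) (λ e → h e + h e) e)
    (cong -_ (linear-+ (spread-linear i) h h e))
  spread-cosOp {B} i (just (suc (suc k))) h e with k ℕ.<? B
  ... | yes k<B = spread-comm i (fromℕ< k<B) h e
  ... | no _ = refl

  cosOp-spread : ∀ {B} k → k ℕ.< B → ∃[ i ] (toℕ {B} i ≡ k × cosOp (just (suc (suc k))) ≡ spread i)
  cosOp-spread {B} k k<B with k ℕ.<? B
  ... | yes p = fromℕ< p , Finₚ.toℕ-fromℕ< p , refl
  ... | no ¬p = contradiction k<B ¬p

  -- The geometric representation and the order of st

  module Representation {n : ℕ} (M : CoxeterMatrix n) (B : ℕ)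
    (bound : ∀ i j k → m M i j ≡ just k → k ℕ.< suc (suc B)) where

    F : Set
    F = Vec ℤ B → ℤ

    c : Fin n → Fin n → F → F
    c s t = cosOp (m M s t)

    c-sym : ∀ s t h e → c s t h e ≡ c t s h e
    c-sym s t h e = cong (λ μ → cosOp μ h e) (CoxeterMatrix.sym M s t)

    c-diag : ∀ s h e → c s s h e ≡ - (h e + h e)
    c-diag s h e = cong (λ μ → cosOp μ h e) (diag M s)

    c-linear : ∀ s t → Linear (c s t)
    c-linear s t = cosOp-linear (m M s t)

    -- The submodule on which each `spread i` satisfies the equation of 2 cos (π/k). On arbitrary
    -- functions it satisfies none, so the Coxeter relations are proved only for vectors with
    -- admissible coordinates.
    Admissible : F → Set
    Admissible h = ∀ i e → cheb (spread i) (order i) h e ≡ 0ℤ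

    admissible-0 : Admissible (λ _ → 0ℤ)
    admissible-0 i = linear-0 (cheb-linear (spread-linear i) (order i)) (λ _ → refl)

    admissible-+ : ∀ {h h'} → Admissible h → Admissible h' → Admissible (λ e → h e + h' e)
    admissible-+ {h} {h'} a a' i e =
      ≡.trans (cheb-+ (spread-linear i) (order i) h h' e) (cong₂ _+_ (a i e) (a' i e))

    admissible-neg : ∀ {h} → Admissible h → Admissible (λ e → - h e)
    admissible-neg {h} a i e = ≡.trans (cheb-neg (spread-linear i) (order i) h e) (cong -_ (a i e))

    admissible-sub : ∀ {h h'} → Admissible h → Admissible h' → Admissible (λ e → h e - h' e)
    admissible-sub a a' = admissible-+ a (admissible-neg a')

    admissible-c : ∀ s t {h} → Admissible h → Admissible (c s t h)
    admissible-c s t {h} a i e = ≡.trans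
      (cheb-comm (spread-linear i) (c-linear s t) (spread-cosOp i (m M s t)) (order i) h e)
      (linear-0 (c-linear s t) (a i) e)

    admissible-∑ : ∀ {k} {f : Fin k → F} → (∀ i → Admissible (f i)) → Admissible (λ e → ∑ (λ i → f i e))
    admissible-∑ {zero} a = admissible-0
    admissible-∑ {suc k} a = admissible-+ (a zero) (admissible-∑ (a ∘ suc))

    V : Set
    V = Fin n → F

    infix 4 _≐_
    _≐_ : V → V → Set
    v ≐ w = ∀ u → v u ≗ w u

    ≐-trans : ∀ {u v w} → u ≐ v → v ≐ w → u ≐ w
    ≐-trans p q i e = ≡.trans (p i e) (q i e)

    ≐-sym : ∀ {u v} → u ≐ v → v ≐ u
    ≐-sym p i e = ≡.sym (p i e)

    AdmissibleV : V → Set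
    AdmissibleV v = ∀ u → Admissible (v u)

    -- In the basis of simple roots this is -2B(α_s, v), so `reflect s` is v ↦ v - 2B(α_s, v)α_s;
    -- the diagonal scalar -2 reflects B(α_s, α_s) = 1.
    form : Fin n → V → F
    form s v e = ∑ (λ t → c s t (v t) e)

    reflect : Fin n → V → V
    reflect s v u with u Finₚ.≟ s
    ... | yes _ = λ e → v s e + form s v e
    ... | no  _ = v u

    reflect-≡ : ∀ s v e → reflect s v s e ≡ v s e + form s v e
    reflect-≡ s v e with s Finₚ.≟ s
    ... | yes _ = refl
    ... | no s≢s = contradiction refl s≢s

    reflect-≢ : ∀ s v {u} → u ≢ s → reflect s v u ≡ v u
    reflect-≢ s v {u} u≢s with u Finₚ.≟ s
    ... | yes u≡s = contradiction u≡s u≢s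
    ... | no _ = refl

    form-cong : ∀ s {v w} → v ≐ w → form s v ≗ form s w
    form-cong s p e = ∑-cong (λ t → linear-cong (c-linear s t) (p t) e)

    reflect-cong : ∀ s {v w} → v ≐ w → reflect s v ≐ reflect s w
    reflect-cong s p u e with u Finₚ.≟ s
    ... | yes _ = cong₂ _+_ (p s e) (form-cong s p e)
    ... | no _ = p u e

    reflect-admissible : ∀ s {v} → AdmissibleV v → AdmissibleV (reflect s v)
    reflect-admissible s a u with u Finₚ.≟ s
    ... | yes _ = admissible-+ (a s) (admissible-∑ (λ t → admissible-c s t (a t)))
    ... | no _ = a u

    form-reflect : ∀ r s v e → form r (reflect s v) e ≡ form r v e + (c r s (reflect s v s) e - c r s (v s) e)
    form-reflect r s v e = ∑-update (λ t → c r t (v t) e) (λ t → c r t (reflect s v t) e) s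
      (λ t t≢s → cong (λ h → c r t h e) (reflect-≢ s v t≢s))

    reflect-involution : ∀ s v → reflect s (reflect s v) ≐ v
    reflect-involution s v u e with u Finₚ.≟ s
    ... | no u≢s = cong (λ h → h e) (reflect-≢ s v u≢s)
    ... | yes refl = ≡.trans
      (cong (λ z → reflect s v s e + z)
        (≡.trans (form-reflect s s v e) (cong (λ z → form s v e + z) (cong₂ _-_ (c-diag s _ e) (c-diag s _ e)))))
      (≡.trans (cong (λ z → z + (form s v e + (- (z + z) - - (v s e + v s e)))) (reflect-≡ s v e))
        (lem (v s e) (form s v e)))
      where
      lem : ∀ a f → (a + f) + (f + (- ((a + f) + (a + f)) - - (a + a))) ≡ a
      lem = solve-∀

    act : Word n → V → V
    act [] v = v
    act (s ∷ w) v = act w (reflect s v)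

    act-++ : ∀ u w v → act (u ++ w) v ≡ act w (act u v)
    act-++ [] w v = refl
    act-++ (s ∷ u) w v = act-++ u w (reflect s v)

    act-cong : ∀ w {v v'} → v ≐ v' → act w v ≐ act w v'
    act-cong [] p = p
    act-cong (s ∷ w) p = act-cong w (reflect-cong s p)

    act-admissible : ∀ w {v} → AdmissibleV v → AdmissibleV (act w v)
    act-admissible [] a = a
    act-admissible (s ∷ w) a = act-admissible w (reflect-admissible s a)

    act-inverse : ∀ w v → act (inv w) (act w v) ≐ v
    act-inverse [] v u e = refl
    act-inverse (s ∷ w) v = ≐-trans
      (λ u e → cong (λ x → act x (act w (reflect s v)) u e) (Lₚ.unfold-reverse s w))
      (≐-trans (λ u e → cong (λ x → x u e) (act-++ (inv w) [ s ] (act w (reflect s v))))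
      (≐-trans (reflect-cong s (act-inverse w (reflect s v))) (reflect-involution s v)))

    -- On letters: the one that comes next after k letters of the alternating word. It also selects
    -- the inhomogeneous term of the recurrence, which alternates in step.
    parity : ∀ {X : Set} → X → X → ℕ → X
    parity a b zero = a
    parity a b (suc k) = parity b a k

    -- The coordinates of the successive images of a vector under s, t, s, … in the plane of s and t;
    -- a and b are the initial coordinates at s and t, while A and B are the invariant contributions
    -- of the other coordinates.
    orbit : (F → F) → F → F → F → F → ℕ → F
    orbit C A B a b zero = a
    orbit C A B a b (suc k) = orbit C B A b (λ e → (C b e - a e) + A e) k

    orbit-step : ∀ C A B a b k e → orbit C A B a b (suc (suc k)) e ≡
      (C (orbit C A B a b (suc k)) e - orbit C A B a b k e) + parity A B k e
    orbit-step C A B a b zero e = refl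
    orbit-step C A B a b (suc k) e = orbit-step C B A b _ k e

    orbit-admissible : ∀ {s t} {A B a b} → Admissible A → Admissible B → Admissible a → Admissible b →
      ∀ k → Admissible (orbit (c s t) A B a b k)
    orbit-admissible _ _ α _ zero = α
    orbit-admissible {s} {t} p q α β (suc k) =
      orbit-admissible {s} {t} q p β (admissible-+ (admissible-sub (admissible-c s t β) α) p) k

    record Plane (s t : Fin n) (C : F → F) (A B a b : F) (v : V) : Set where
      field
        at-s   : v s ≗ a
        at-t   : v t ≗ b
        form-s : ∀ e → form s v e ≡ (C b e - (a e + a e)) + A e
        form-t : ∀ e → form t v e ≡ (C a e - (b e + b e)) + B e

    plane-step : ∀ {s t C A B a b v} → s ≢ t → Linear C → (∀ h → c s t h ≗ C h) → Plane s t C A B a b v →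
      Plane t s C B A b (λ e → (C b e - a e) + A e) (reflect s v)
    plane-step {s} {t} {C} {A} {B} {a} {b} {v} s≢t lin c≗C P = record
      { at-s = λ e → ≡.trans (cong (λ h → h e) (reflect-≢ s v (s≢t ∘ ≡.sym))) (at-t e)
      ; at-t = new
      ; form-s = λ e → ≡.trans (form-reflect t s v e)
          (≡.trans (cong₂ _+_ (form-t e) (cong₂ _-_
            (≡.trans (c-sym t s _ e) (≡.trans (c≗C _ e) (linear-cong lin new e)))
            (≡.trans (c-sym t s _ e) (≡.trans (c≗C _ e) (linear-cong lin at-s e)))))
          (lem₁ (C a e) (b e) (B e) (C (λ e → (C b e - a e) + A e) e)))
      ; form-t = λ e → ≡.trans (form-reflect s s v e)
          (≡.trans (cong₂ _+_ (form-s e) (cong₂ _-_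
            (≡.trans (c-diag s _ e) (cong (λ z → - (z + z)) (new e)))
            (≡.trans (c-diag s _ e) (cong (λ z → - (z + z)) (at-s e)))))
          (lem₂ (C b e) (a e) (A e)))
      }
      where
      open Plane P

      new : reflect s v s ≗ λ e → (C b e - a e) + A e
      new e = ≡.trans (reflect-≡ s v e) (≡.trans (cong₂ _+_ (at-s e) (form-s e)) (lem (C b e) (a e) (A e)))
        where
        lem : ∀ x a y → a + ((x - (a + a)) + y) ≡ (x - a) + y
        lem = solve-∀
      lem₁ : ∀ x b y z → ((x - (b + b)) + y) + (z - x) ≡ (z - (b + b)) + y
      lem₁ = solve-∀
      lem₂ : ∀ x a y → ((x - (a + a)) + y) + (- (((x - a) + y) + ((x - a) + y)) - - (a + a)) ≡ (x - (((x - a) + y) + ((x - a) + y))) + y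
      lem₂ = solve-∀

    plane-act : ∀ {s t C A B a b v} → s ≢ t → Linear C → (∀ h → c s t h ≗ C h) → Plane s t C A B a b v →
      ∀ k → act (altFrom s t k) v (parity s t k) ≗ orbit C A B a b k ×
            act (altFrom s t k) v (parity t s k) ≗ orbit C A B a b (suc k)
    plane-act s≢t lin c≗C P zero = Plane.at-s P , Plane.at-t P
    plane-act {s} {t} s≢t lin c≗C P (suc k) =
      plane-act (s≢t ∘ ≡.sym) lin (λ h e → ≡.trans (c-sym t s h e) (c≗C h e)) (plane-step s≢t lin c≗C P) k

    act-fixed : ∀ s t k v {u} → u ≢ s → u ≢ t → act (altFrom s t k) v u ≡ v u
    act-fixed s t zero v u≢s u≢t = refl
    act-fixed s t (suc k) v {u} u≢s u≢t =
      ≡.trans (act-fixed t s k (reflect s v) u≢t u≢s) (reflect-≢ s v u≢s)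

    plane-swap : ∀ {s t C A B a b v} → Plane s t C A B a b v → Plane t s C B A b a v
    plane-swap P = record { at-s = at-t ; at-t = at-s ; form-s = form-t ; form-t = form-s }
      where open Plane P

    -- The forward and backward orbits are the two halves of one doubly infinite sequence; its
    -- differences about a centre satisfy the homogeneous recurrence, since A and B alternate.
    orbit-diff₁ : ∀ {C} → Linear C → ∀ A B a b k e →
      orbit C A B a b k e - orbit C B A b a (suc k) e ≡
      cheb C k (λ e → orbit C A B a b 1 e - orbit C B A b a 2 e) e
    orbit-diff₁ {C} lin A B a b k e = cheb-unique lin
      (λ k e → orbit C A B a b k e - orbit C B A b a (suc k) e)
      (λ e → ℤₚ.+-inverseʳ (a e))
      (λ k e → ≡.trans
        (cong₂ _-_ (orbit-step C A B a b k e) (orbit-step C B A b a (suc k) e))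
        (≡.trans (lem (C (orbit C A B a b (suc k)) e) (orbit C A B a b k e) (parity A B k e)
                      (C (orbit C B A b a (suc (suc k))) e) (orbit C B A b a (suc k) e))
          (cong (λ z → z - (orbit C A B a b k e - orbit C B A b a (suc k) e))
            (≡.sym (linear-sub lin (orbit C A B a b (suc k)) (orbit C B A b a (suc (suc k))) e)))))
      k e
      where
      lem : ∀ x a y x' a' → ((x - a) + y) - ((x' - a') + y) ≡ (x - x') - (a - a')
      lem = solve-∀

    -- The previous identity with the two letters exchanged, up to sign; together they compare both
    -- coordinates of the plane.
    orbit-diff₂ : ∀ {C} → Linear C → ∀ A B a b k e →
      orbit C A B a b (suc k) e - orbit C B A b a k e ≡
      cheb C k (λ e → orbit C A B a b 2 e - orbit C B A b a 1 e) e
    orbit-diff₂ {C} lin A B a b k e = ≡.trans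
      (lem (orbit C A B a b (suc k) e) (orbit C B A b a k e))
      (≡.trans (cong -_ (orbit-diff₁ lin B A b a k e))
      (≡.trans (≡.sym (cheb-neg lin k (λ e → orbit C B A b a 1 e - orbit C A B a b 2 e) e))
        (cheb-cong lin k (λ e → ≡.sym (lem (orbit C A B a b 2 e) (orbit C B A b a 1 e))) e)))
      where
      lem : ∀ x y → x - y ≡ - (y - x)
      lem = solve-∀

    -- The outside contributions are found by solving the two equations for them, which avoids
    -- splitting the sums over the generators.
    planeOf : ∀ {s t} v → Plane s t (c s t)
      (λ e → (form s v e + (v s e + v s e)) - c s t (v t) e)
      (λ e → (form t v e + (v t e + v t e)) - c s t (v s) e) (v s) (v t) v
    planeOf {s} {t} v = record
      { at-s = λ _ → refl ; at-t = λ _ → refl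
      ; form-s = λ e → lem (form s v e) (v s e) (c s t (v t) e)
      ; form-t = λ e → lem (form t v e) (v t e) (c s t (v s) e) }
      where
      lem : ∀ f a x → f ≡ (x - (a + a)) + ((f + (a + a)) - x)
      lem = solve-∀

    admissible-cheb : ∀ s t k → m M s t ≡ just k → s ≢ t → ∀ {h} → Admissible h → ∀ e → cheb (c s t) k h e ≡ 0ℤ
    admissible-cheb s t k mst s≢t a e with offdiag M s t s≢t k mst | bound s t k mst
    ... | s≤s (s≤s {n = k'} _) | s≤s (s≤s k'<B)
      with i , refl , op ← cosOp-spread k' k'<B =
      ≡.trans (cong (λ f → cheb f k _ e) (≡.trans (cong cosOp mst) op)) (a i e)

    -- Both words fix the coordinates other than s and t. In these two the results differ by the
    -- k-th Chebyshev polynomial applied to an admissible function, the counterpart of sin (k · π/k)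
    -- = 0.
    act-braid : ∀ s t k → m M s t ≡ just k → s ≢ t → ∀ {v} → AdmissibleV v →
      act (altFrom s t k) v ≐ act (altFrom t s k) v
    act-braid s t k mst s≢t {v} adm u e = byParity (parity-cases k)
      where
      C = c s t
      A B' : F
      A = λ e → (form s v e + (v s e + v s e)) - c s t (v t) e
      B' = λ e → (form t v e + (v t e + v t e)) - c s t (v s) e
      adm-form : ∀ r → Admissible (form r v)
      adm-form r = admissible-∑ (λ q → admissible-c r q (adm q))
      adm-A : Admissible A
      adm-A = admissible-sub (admissible-+ (adm-form s) (admissible-+ (adm s) (adm s))) (admissible-c s t (adm t))
      adm-B : Admissible B'
      adm-B = admissible-sub (admissible-+ (adm-form t) (admissible-+ (adm t) (adm t))) (admissible-c s t (adm s))
      adm-orbit : ∀ k → Admissible (orbit C A B' (v s) (v t) k)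
      adm-orbit = orbit-admissible {s} {t} adm-A adm-B (adm s) (adm t)
      adm-orbit' : ∀ k → Admissible (orbit C B' A (v t) (v s) k)
      adm-orbit' = orbit-admissible {s} {t} adm-B adm-A (adm t) (adm s)
      fwd = plane-act s≢t (c-linear s t) (λ _ _ → refl) (planeOf v) k
      bwd = plane-act (s≢t ∘ ≡.sym) (c-linear s t) (c-sym t s) (plane-swap (planeOf v)) k
      eq₁ : act (altFrom s t k) v (parity s t k) e ≡ act (altFrom t s k) v (parity s t k) e
      eq₁ = ≡.trans (proj₁ fwd e) (≡.trans
        (ℤₚ.i-j≡0⇒i≡j _ _ (≡.trans (orbit-diff₁ (c-linear s t) A B' (v s) (v t) k e)
          (admissible-cheb s t k mst s≢t (admissible-sub (adm-orbit 1) (adm-orbit' 2)) e)))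
        (≡.sym (proj₂ bwd e)))
      eq₂ : act (altFrom s t k) v (parity t s k) e ≡ act (altFrom t s k) v (parity t s k) e
      eq₂ = ≡.trans (proj₂ fwd e) (≡.trans
        (ℤₚ.i-j≡0⇒i≡j _ _ (≡.trans (orbit-diff₂ (c-linear s t) A B' (v s) (v t) k e)
          (admissible-cheb s t k mst s≢t (admissible-sub (adm-orbit 2) (adm-orbit' 1)) e)))
        (≡.sym (proj₁ bwd e)))
      parity-cases : ∀ k → (parity s t k ≡ s × parity t s k ≡ t) ⊎ (parity s t k ≡ t × parity t s k ≡ s)
      parity-cases zero = inj₁ (refl , refl)
      parity-cases (suc k) with parity-cases k
      ... | inj₁ (p , q) = inj₂ (q , p)
      ... | inj₂ (p , q) = inj₁ (q , p)
      Goal : Fin n → Set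
      Goal u = act (altFrom s t k) v u e ≡ act (altFrom t s k) v u e
      at : Goal s → Goal t → Goal u
      at gs gt with u Finₚ.≟ s | u Finₚ.≟ t
      ... | yes refl | _ = gs
      ... | no _ | yes refl = gt
      ... | no u≢s | no u≢t =
        cong (λ h → h e) (≡.trans (act-fixed s t k v u≢s u≢t) (≡.sym (act-fixed t s k v u≢t u≢s)))
      byParity : (parity s t k ≡ s × parity t s k ≡ t) ⊎ (parity s t k ≡ t × parity t s k ≡ s) → Goal u
      byParity (inj₁ (p , q)) = at (subst Goal p eq₁) (subst Goal q eq₂)
      byParity (inj₂ (p , q)) = at (subst Goal q eq₂) (subst Goal p eq₁)

    act-alt : ∀ s t k → m M s t ≡ just k → ∀ {v} → AdmissibleV v → act (alt s t k) v ≐ v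
    act-alt s t k mst {v} adm with s Finₚ.≟ t
    ... | yes refl rewrite just-injective (≡.trans (≡.sym mst) (diag M s)) = reflect-involution s v
    ... | no s≢t =
      ≐-trans (λ u e → cong (λ x → act x v u e) (alt-altFrom s t k))
      (≐-trans (λ u e → cong (λ x → x u e) (act-++ (altFrom s t k) (inv (altFrom t s k)) v))
      (≐-trans (act-cong (inv (altFrom t s k)) (act-braid s t k mst s≢t adm))
        (act-inverse (altFrom t s k) v)))

    act-invariant : ∀ {u w} → Eq M u w → ∀ {v} → AdmissibleV v → act u v ≐ act w v
    act-invariant ~-refl adm u e = refl
    act-invariant (~-sym p) adm = ≐-sym (act-invariant p adm)
    act-invariant (~-trans p q) adm = ≐-trans (act-invariant p adm) (act-invariant q adm)
    act-invariant (~-cong {u} {u'} {w} {w'} p q) {v} adm =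
      ≐-trans (λ i e → cong (λ x → x i e) (act-++ u w v))
      (≐-trans (act-cong w (act-invariant p adm))
      (≐-trans (act-invariant q (act-admissible u' adm))
        (λ i e → cong (λ x → x i e) (≡.sym (act-++ u' w' v)))))
    act-invariant (~-rel s t k mst) adm = act-alt s t k mst adm

    testVector : Fin n → V
    testVector t u with u Finₚ.≟ t
    ... | yes _ = testFunction
    ... | no  _ = λ _ → 0ℤ

    testVector-admissible : ∀ t → AdmissibleV (testVector t)
    testVector-admissible t u with u Finₚ.≟ t
    ... | yes _ = cheb-order-testFunction
    ... | no  _ = admissible-0

    form-testVector : ∀ t e → form t (testVector t) e ≡ - (testFunction e + testFunction e)
    form-testVector t e = begin
      form t (testVector t) e
        ≡⟨ ∑-update (λ _ → 0ℤ) _ t off ⟩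
      ∑ {n} (λ _ → 0ℤ) + (c t t (testVector t t) e - 0ℤ)
        ≡⟨ cong₂ _+_ (∑-0 {n} (λ _ → refl)) (ℤₚ.+-identityʳ (c t t (testVector t t) e)) ⟩
      0ℤ + c t t (testVector t t) e
        ≡⟨ ℤₚ.+-identityˡ (c t t (testVector t t) e) ⟩
      c t t (testVector t t) e
        ≡⟨ c-diag t (testVector t t) e ⟩
      - (testVector t t e + testVector t t e)
        ≡⟨ cong (λ z → - (z + z)) (cong (λ h → h e) on) ⟩
      - (testFunction e + testFunction e) ∎
      where
      open ≡.≡-Reasoning
      on : testVector t t ≡ testFunction
      on with t Finₚ.≟ t
      ... | yes _ = refl
      ... | no t≢t = contradiction refl t≢t
      off : ∀ u → u ≢ t → c t u (testVector t u) e ≡ 0ℤ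
      off u u≢t with u Finₚ.≟ t
      ... | yes u≡t = contradiction u≡t u≢t
      ... | no _ = linear-0 (c-linear t u) (λ _ → refl) e

    cheb-testFunction-positive : ∀ s t d → s ≢ t → 0 ℕ.< d → (∀ k → m M s t ≡ just k → d ℕ.< k) →
      ∃[ e ] ∃[ z ] cheb (c s t) d testFunction e ≡ + suc z
    cheb-testFunction-positive s t d@(suc d') s≢t 0<d d< = go (m M s t) refl
      where
      go : ∀ μ → m M s t ≡ μ → ∃[ e ] ∃[ z ] cheb (cosOp μ) d testFunction e ≡ + suc z
      go nothing _ = replicate B 1ℤ , d' , ≡.trans (cheb-double d testFunction _)
        (≡.trans (cong (+ suc d' *_) (testFunction-ones {B})) (ℤₚ.*-identityʳ (+ suc d')))
      go (just k) mst with offdiag M s t s≢t k mst | bound s t k mst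
      ... | s≤s (s≤s {n = k'} _) | s≤s (s≤s k'<B)
        with i , i≡k' , op ← cosOp-spread k' k'<B
        with e , eq ← cheb-testFunction-≢0 i d 0<d (subst (λ j → d ℕ.< suc (suc j)) (≡.sym i≡k') (d< k mst)) =
        e , 0 , ≡.trans (cong (λ f → cheb f d testFunction e) op) eq

    -- On the root of t scaled by the test function f, the two words differ in one coordinate by the
    -- d-th Chebyshev polynomial applied to 2f, and some value of that is positive.
    altFrom-≢ : ∀ s t d → s ≢ t → 0 ℕ.< d → (∀ k → m M s t ≡ just k → d ℕ.< k) →
      ¬ Eq M (altFrom s t d) (altFrom t s d)
    altFrom-≢ s t d s≢t 0<d d< p with e , z , eq ← cheb-testFunction-positive s t d s≢t 0<d d< =
      case ≡.trans (≡.sym (cong₂ _+_ eq eq)) 2y≡0 of λ ()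
      where
      v = testVector t
      C = c s t
      A B' : F
      A = λ e → (form s v e + (v s e + v s e)) - c s t (v t) e
      B' = λ e → (form t v e + (v t e + v t e)) - c s t (v s) e
      y : F
      y e = orbit C A B' (v s) (v t) 1 e - orbit C B' A (v t) (v s) 2 e
      -- The reflection in t negates its own root, so the coordinate at t passes from f to -f; hence
      -- the factor 2.
      y≗ : ∀ e → y e ≡ testFunction e + testFunction e
      y≗ e = ≡.trans (lem (v t e) (C (v s) e) (form t v e))
        (≡.trans (cong -_ (form-testVector t e)) (ℤₚ.neg-involutive _))
        where
        lem : ∀ b x f → b - ((x - b) + ((f + (b + b)) - x)) ≡ - f
        lem = solve-∀
      y0 : ∀ e → cheb C d y e ≡ 0ℤ
      y0 e = ≡.trans (≡.sym (orbit-diff₁ (c-linear s t) A B' (v s) (v t) d e))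
        (ℤₚ.i≡j⇒i-j≡0 (≡.trans (≡.sym (proj₁ (plane-act s≢t (c-linear s t) (λ _ _ → refl) (planeOf v) d) e))
          (≡.trans (act-invariant p (testVector-admissible t) (parity s t d) e)
            (proj₂ (plane-act (s≢t ∘ ≡.sym) (c-linear s t) (c-sym t s) (plane-swap (planeOf v)) d) e))))
      2y≡0 : ∀ {e} → cheb C d testFunction e + cheb C d testFunction e ≡ 0ℤ
      2y≡0 {e} = ≡.trans (≡.sym (cheb-+ (c-linear s t) d testFunction testFunction e))
        (≡.trans (cheb-cong (c-linear s t) d (λ e → ≡.sym (y≗ e)) e) (y0 e))

  upperBound : ∀ {n} (f : Fin n → ℕ) → ∃[ B ] ∀ i → f i ℕ.≤ B
  upperBound {zero} f = 0 , λ ()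
  upperBound {suc n} f with B , f≤B ← upperBound (f ∘ suc) = f zero ℕ.⊔ B , λ
    { zero → ℕₚ.m≤m⊔n (f zero) B
    ; (suc i) → ℕₚ.≤-trans (f≤B i) (ℕₚ.m≤n⊔m (f zero) B) }

  -- Equivalently, st has order exactly m(s,t).
  opaque
    alternating-distinct : ∀ {n} (M : CoxeterMatrix n) s t d → s ≢ t → 0 ℕ.< d →
      (∀ k → m M s t ≡ just k → d ℕ.< k) → ¬ Eq M (altFrom s t d) (altFrom t s d)
    alternating-distinct {n} M = Representation.altFrom-≢ M B bound
      where
      entry : Fin n → Fin n → ℕ
      entry i j = fromMaybe 0 (m M i j)
      B : ℕ
      B = proj₁ (upperBound (λ i → proj₁ (upperBound (entry i))))
      bound : ∀ i j k → m M i j ≡ just k → k ℕ.< suc (suc B)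
      bound i j k mij = s≤s (ℕₚ.m≤n⇒m≤1+n (ℕₚ.≤-trans
        (subst (λ μ → fromMaybe 0 μ ℕ.≤ proj₁ (upperBound (entry i))) mij (proj₂ (upperBound (entry i)) j))
        (proj₂ (upperBound (λ i → proj₁ (upperBound (entry i)))) i)))

open GeometricRepresentation using (alternating-distinct)
open import Data.Nat using (_+_; _*_; _∸_; _<_; _≤_)

alt-+ : ∀ {n} (s t : Fin n) j k → alt s t (j + k) ≡ alt s t j ++ alt s t k
alt-+ s t zero k = refl
alt-+ s t (suc j) k = cong (λ w → s ∷ t ∷ w) (alt-+ s t j k)

inv-alt : ∀ {n} (s t : Fin n) k → inv (alt s t k) ≡ alt t s k
inv-alt s t zero = refl
inv-alt s t (suc k) =
  ≡.trans (Lₚ.reverse-++ (s ∷ t ∷ []) (alt s t k))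
    (≡.trans (cong (_++ t ∷ s ∷ []) (inv-alt s t k)) (go k))
  where
  go : ∀ k → alt t s k ++ t ∷ s ∷ [] ≡ t ∷ s ∷ alt t s k
  go zero = refl
  go (suc k) = cong (λ w → t ∷ s ∷ w) (go k)

-- Inversions modulo 2, deletion and strong exchange

module Reflections {n : ℕ} (M : CoxeterMatrix n) where

  infix 4 _≈_
  _≈_ : Word n → Word n → Set
  _≈_ = Eq M

  wordSetoid : Setoid _ _
  wordSetoid = record
    { Carrier = Word n ; _≈_ = _≈_
    ; isEquivalence = record { refl = ~-refl ; sym = ~-sym ; trans = ~-trans } }

  open import Data.List.Relation.Binary.Equality.Setoid wordSetoid using (_≋_)
  open import Data.List.Relation.Binary.Permutation.Setoid wordSetoid
    using (_↭_; ↭-refl; ↭-sym; ↭-trans; ↭-prep; prep; ↭-reflexive; ↭-reflexive-≋; module PermutationReasoning)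
  import Data.List.Relation.Binary.Permutation.Setoid.Properties wordSetoid as ↭ₚ
  open import Data.List.Membership.Setoid wordSetoid using (_∈_)
  import Data.List.Membership.Setoid.Properties as ∈ₚ
  import Algebra.Properties.CommutativeSemigroup as CS
  open CS (CommutativeMonoid.commutativeSemigroup ↭ₚ.++-commutativeMonoid) using (interchange)

  ≈-reflexive : ∀ {u v} → u ≡ v → u ≈ v
  ≈-reflexive refl = ~-refl

  ++-congˡ : ∀ u {v v'} → v ≈ v' → u ++ v ≈ u ++ v'
  ++-congˡ u = ~-cong ~-refl

  ++-congʳ : ∀ {u u'} v → u ≈ u' → u ++ v ≈ u' ++ v
  ++-congʳ v p = ~-cong p ~-refl

  ∷-cong : ∀ s {v v'} → v ≈ v' → s ∷ v ≈ s ∷ v'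
  ∷-cong s = ++-congˡ [ s ]

  open import Relation.Binary.Reasoning.Setoid wordSetoid

  ss≈ : ∀ s w → s ∷ s ∷ w ≈ w
  ss≈ s w = ++-congʳ w (~-rel s s 1 (diag M s))

  ∷-cancel : ∀ s {u v} → s ∷ u ≈ s ∷ v → u ≈ v
  ∷-cancel s {u} {v} p = begin
    u          ≈⟨ ss≈ s u ⟨
    s ∷ s ∷ u  ≈⟨ ∷-cong s p ⟩
    s ∷ s ∷ v  ≈⟨ ss≈ s v ⟩
    v          ∎

  inv-inverseˡ : ∀ u v → inv u ++ u ++ v ≈ v
  inv-inverseˡ [] v = ~-refl
  inv-inverseˡ (s ∷ u) v = begin
    inv (s ∷ u) ++ s ∷ u ++ v  ≡⟨ inv-∷ s u (s ∷ u ++ v) ⟩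
    inv u ++ s ∷ s ∷ u ++ v    ≈⟨ ++-congˡ (inv u) (ss≈ s (u ++ v)) ⟩
    inv u ++ u ++ v            ≈⟨ inv-inverseˡ u v ⟩
    v                          ∎

  inv-inverseʳ : ∀ u v → u ++ inv u ++ v ≈ v
  inv-inverseʳ u v =
    ~-trans (≈-reflexive (cong (_++ inv u ++ v) (≡.sym (Lₚ.reverse-involutive u))))
            (inv-inverseˡ (inv u) v)

  ++-cancelʳ : ∀ {u v} w → u ++ w ≈ v ++ w → u ≈ v
  ++-cancelʳ {u} {v} w p = begin
    u                        ≈⟨ undo u ⟨
    (u ++ w) ++ inv w        ≈⟨ ++-congʳ (inv w) p ⟩
    (v ++ w) ++ inv w        ≈⟨ undo v ⟩
    v                        ∎
    where
    undo : ∀ x → (x ++ w) ++ inv w ≈ x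
    undo x = begin
      (x ++ w) ++ inv w        ≡⟨ Lₚ.++-assoc x w (inv w) ⟩
      x ++ w ++ inv w          ≡⟨ cong (λ z → x ++ w ++ z) (Lₚ.++-identityʳ (inv w)) ⟨
      x ++ w ++ inv w ++ []    ≈⟨ ++-congˡ x (inv-inverseʳ w []) ⟩
      x ++ []                  ≡⟨ Lₚ.++-identityʳ x ⟩
      x                        ∎

  inv-cong : ∀ {u v} → u ≈ v → inv u ≈ inv v
  inv-cong {u} {v} p = ++-cancelʳ u (begin
    inv u ++ u        ≡⟨ cong (inv u ++_) (Lₚ.++-identityʳ u) ⟨
    inv u ++ u ++ []  ≈⟨ inv-inverseˡ u [] ⟩
    []                ≈⟨ inv-inverseˡ v [] ⟨
    inv v ++ v ++ []  ≡⟨ cong (inv v ++_) (Lₚ.++-identityʳ v) ⟩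
    inv v ++ v        ≈⟨ ++-congˡ (inv v) p ⟨
    inv v ++ u        ∎)

  conj : Word n → Word n → Word n
  conj w r = inv w ++ r ++ w

  conj-cong : ∀ {v w r r'} → v ≈ w → r ≈ r' → conj v r ≈ conj w r'
  conj-cong p q = ~-cong (inv-cong p) (~-cong q p)

  conj-congʳ : ∀ w {r r'} → r ≈ r' → conj w r ≈ conj w r'
  conj-congʳ w = conj-cong (~-refl {u = w})

  conj-∘ : ∀ v u r → conj v (conj u r) ≡ conj (u ++ v) r
  conj-∘ v u r = ≡.sym (≡.trans
    (cong (_++ r ++ u ++ v) (Lₚ.reverse-++ u v))
    (≡.trans (Lₚ.++-assoc (inv v) (inv u) _)
      (cong (inv v ++_) (≡.sym (≡.trans (Lₚ.++-assoc (inv u) (r ++ u) v)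
                                (cong (inv u ++_) (Lₚ.++-assoc r u v)))))))

  conj-involution : ∀ p r → p ++ p ≈ [] → conj p (conj p r) ≈ r
  conj-involution p r pp = begin
    conj p (conj p r)  ≡⟨ conj-∘ p p r ⟩
    conj (p ++ p) r    ≈⟨ conj-cong pp ~-refl ⟩
    r ++ []            ≡⟨ Lₚ.++-identityʳ r ⟩
    r                  ∎

  ++-conj : ∀ w r → w ++ conj w r ≈ r ++ w
  ++-conj w r = inv-inverseʳ w (r ++ w)

  conj-self : ∀ p → conj p p ≈ p
  conj-self p = inv-inverseˡ p p

  N : Word n → List (Word n)
  N [] = []
  N (s ∷ w) = conj w [ s ] ∷ N w

  N-++ : ∀ u v → N (u ++ v) ≡ map (conj v) (N u) ++ N v
  N-++ [] v = refl
  N-++ (s ∷ u) v = cong₂ _∷_ (≡.sym (conj-∘ v u [ s ])) (N-++ u v)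

  length-N : ∀ w → length (N w) ≡ length w
  length-N [] = refl
  length-N (s ∷ w) = cong suc (length-N w)

  data Deletion : Word n → Word n → Set where
    here  : ∀ {s w} → Deletion (s ∷ w) w
    there : ∀ {s w w'} → Deletion w w' → Deletion (s ∷ w) (s ∷ w')

  Deletion-length : ∀ {w w'} → Deletion w w' → length w ≡ suc (length w')
  Deletion-length here = refl
  Deletion-length (there d) = cong suc (Deletion-length d)

  ∈N⇒Deletion : ∀ w {r} → r ∈ N w → ∃[ w' ] (Deletion w w' × w ++ r ≈ w')
  ∈N⇒Deletion (s ∷ w) {r} (here e) = w , here ,
    (begin
      s ∷ w ++ r              ≈⟨ ∷-cong s (++-congˡ w e) ⟩
      s ∷ w ++ conj w [ s ]   ≈⟨ ∷-cong s (++-conj w [ s ]) ⟩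
      s ∷ s ∷ w               ≈⟨ ss≈ s w ⟩
      w                       ∎)
  ∈N⇒Deletion (s ∷ w) (there r∈) with w' , d , e ← ∈N⇒Deletion w r∈ =
    s ∷ w' , there d , ∷-cong s e

  -- Vanishing of the formal sum over 𝔽₂, with the pairing itself as evidence: occurrences cannot be
  -- counted while equality in W is undecided.
  Balanced : List (Word n) → Set
  Balanced L = ∃[ P ] L ↭ P ++ P

  Balanced-resp-↭ : ∀ {L L'} → L ↭ L' → Balanced L → Balanced L'
  Balanced-resp-↭ σ (P , τ) = P , ↭-trans (↭-sym σ) τ

  Balanced-++ : ∀ {L L'} → Balanced L → Balanced L' → Balanced (L ++ L')
  Balanced-++ (P , σ) (Q , τ) =
    P ++ Q , ↭-trans (↭ₚ.++⁺ σ τ) (interchange P P Q Q)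

  Balanced-map : ∀ {L} v → Balanced L → Balanced (map (conj v) L)
  Balanced-map v (P , σ) = map (conj v) P ,
    ↭-trans (↭ₚ.map⁺ wordSetoid (conj-congʳ v) σ) (↭-reflexive (Lₚ.map-++ (conj v) P P))

  opaque
    ∈⇒↭ : ∀ {x L} → x ∈ L → ∃[ L' ] L ↭ x ∷ L'
    ∈⇒↭ x∈ with ys , zs , w , x≈w , e ← ∈ₚ.∈-∃++ wordSetoid x∈ =
      ys ++ zs , ↭-trans (↭-reflexive-≋ e) (↭ₚ.shift (~-sym x≈w) ys zs)

  ∈-double : ∀ {x} P → x ∈ P ++ P → x ∈ P
  ∈-double P x∈ with ∈ₚ.∈-++⁻ wordSetoid P x∈
  ... | inj₁ p = p
  ... | inj₂ p = p

  opaque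
    -- The entry `x` lies in P, whichever half it comes from, and is taken out of both copies of P;
    -- one of the two is the leading `x`.
    Balanced-uncons : ∀ {x L} → Balanced (x ∷ L) → ∃[ Q ] L ↭ x ∷ Q ++ Q
    Balanced-uncons {x} {L} (P , σ)
      with Q , τ ← ∈⇒↭ (∈-double P (↭ₚ.∈-resp-↭ σ (here ~-refl))) =
      Q , ↭ₚ.drop-∷ (↭-trans σ (↭-trans (↭ₚ.++⁺ τ τ) (↭-prep x (↭ₚ.↭-shift Q Q))))

    Balanced-partner : ∀ {x L} → Balanced (x ∷ L) → x ∈ L
    Balanced-partner b = ↭ₚ.∈-resp-↭ (↭-sym (proj₂ (Balanced-uncons b))) (here ~-refl)

  Balanced-cancel : ∀ {x L} → Balanced (x ∷ x ∷ L) → Balanced L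
  Balanced-cancel b with Q , τ ← Balanced-uncons b = Q , ↭ₚ.drop-∷ τ

  Balanced-cancel-++ : ∀ B {L} → Balanced ((B ++ B) ++ L) → Balanced L
  Balanced-cancel-++ [] b = b
  Balanced-cancel-++ (x ∷ B) {L} b = Balanced-cancel-++ B (Balanced-cancel
    (Balanced-resp-↭ (↭-prep x (↭ₚ.++⁺ʳ L (↭ₚ.↭-shift B B))) b))

  N-alt : ∀ s t k → N (alt s t k) ≡ applyDownFrom (λ i → alt t s i ++ [ t ]) (k + k)
  N-alt s t zero = refl
  N-alt s t (suc k) = ≡.trans (cong₂ _∷_ first (cong₂ _∷_ second (N-alt s t k)))
    (cong (λ L → (alt t s (k + suc k) ++ [ t ]) ∷ L)
      (cong (applyDownFrom (λ i → alt t s i ++ [ t ])) (≡.sym (ℕₚ.+-suc k k))))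
    where
    second : conj (alt s t k) [ t ] ≡ alt t s (k + k) ++ [ t ]
    second = ≡.trans (cong₂ _++_ (inv-alt s t k) (≡.sym (alt-snoc t s k)))
      (≡.trans (≡.sym (Lₚ.++-assoc (alt t s k) (alt t s k) [ t ]))
        (cong (_++ [ t ]) (≡.sym (alt-+ t s k k))))
    first : conj (t ∷ alt s t k) [ s ] ≡ alt t s (k + suc k) ++ [ t ]
    first = ≡.trans (inv-∷ t (alt s t k) _)
      (≡.trans (cong₂ _++_ (inv-alt s t k) (cong (λ w → t ∷ s ∷ w) (≡.sym (alt-snoc t s k))))
        (≡.trans (≡.sym (Lₚ.++-assoc (alt t s k) (alt t s (suc k)) [ t ]))
          (cong (_++ [ t ]) (≡.sym (alt-+ t s k (suc k))))))

  applyDownFrom-+ : ∀ (f : ℕ → Word n) j k →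
    applyDownFrom f (j + k) ≡ applyDownFrom (λ i → f (i + k)) j ++ applyDownFrom f k
  applyDownFrom-+ f zero k = refl
  applyDownFrom-+ f (suc j) k = cong (f (j + k) ∷_) (applyDownFrom-+ f j k)

  applyDownFrom-cong : ∀ {f g : ℕ → Word n} → (∀ i → f i ≈ g i) →
    ∀ k → applyDownFrom f k ≋ applyDownFrom g k
  applyDownFrom-cong e zero = []
  applyDownFrom-cong e (suc k) = e k ∷ applyDownFrom-cong e k

  -- The j-th and (j + k)-th reflections of (st)ᵏ coincide when (ts)ᵏ = 1.
  N-alt-balanced : ∀ s t k → m M s t ≡ just k → Balanced (N (alt s t k))
  N-alt-balanced s t k mst = P ,
    ↭-trans (↭-reflexive (≡.trans (N-alt s t k) (applyDownFrom-+ r k k)))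
            (↭ₚ.++⁺ʳ P (↭-reflexive-≋ (applyDownFrom-cong period k)))
    where
    r : ℕ → Word n
    r i = alt t s i ++ [ t ]
    P = applyDownFrom r k
    period : ∀ i → r (i + k) ≈ r i
    period i = ++-congʳ [ t ] (begin
      alt t s (i + k)          ≡⟨ alt-+ t s i k ⟩
      alt t s i ++ alt t s k   ≈⟨ ++-congˡ (alt t s i) (~-rel t s k (≡.trans (CoxeterMatrix.sym M t s) mst)) ⟩
      alt t s i ++ []          ≡⟨ Lₚ.++-identityʳ _ ⟩
      alt t s i                ∎)

  map-conj-cong : ∀ {v v'} → v ≈ v' → ∀ L → map (conj v) L ≋ map (conj v') L
  map-conj-cong e [] = []
  map-conj-cong e (r ∷ L) = conj-cong e ~-refl ∷ map-conj-cong e L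

  -- Over 𝔽₂ the formal sum of N w depends only on the class of w.
  N-invariant : ∀ {u v} → u ≈ v → Balanced (N u ++ N v)
  N-invariant {u} ~-refl = N u , ↭-refl
  N-invariant {u} {v} (~-sym e) = Balanced-resp-↭ (↭ₚ.++-comm (N v) (N u)) (N-invariant e)
  N-invariant {u} {w} (~-trans {v = v} e f) =
    Balanced-cancel-++ (N v) (Balanced-resp-↭ σ (Balanced-++ (N-invariant e) (N-invariant f)))
    where
    σ : (N u ++ N v) ++ (N v ++ N w) ↭ (N v ++ N v) ++ (N u ++ N w)
    σ = ↭-trans (↭ₚ.++⁺ʳ (N v ++ N w) (↭ₚ.++-comm (N u) (N v))) (interchange (N v) (N u) (N v) (N w))
  N-invariant (~-cong {u} {u'} {v} {v'} e f) =
    Balanced-resp-↭ σ (Balanced-++ (Balanced-map v (N-invariant e)) (N-invariant f))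
    where
    A A' : List (Word n)
    A = map (conj v) (N u)
    A' = map (conj v) (N u')
    σ : map (conj v) (N u ++ N u') ++ (N v ++ N v') ↭ N (u ++ v) ++ N (u' ++ v')
    σ = ↭-trans (↭ₚ.++⁺ʳ (N v ++ N v') (↭-reflexive (Lₚ.map-++ (conj v) (N u) (N u'))))
       (↭-trans (interchange A A' (N v) (N v'))
       (↭ₚ.++⁺ (↭-reflexive (≡.sym (N-++ u v)))
         (↭-trans (↭ₚ.++⁺ʳ (N v') (↭-reflexive-≋ (map-conj-cong f (N u'))))
           (↭-reflexive (≡.sym (N-++ u' v'))))))
  N-invariant (~-rel s t k mst) =
    Balanced-resp-↭ (↭-sym (↭ₚ.++-identityʳ _)) (N-alt-balanced s t k mst)

  data Repetition : List (Word n) → Set where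
    here  : ∀ {x L} → x ∈ L → Repetition (x ∷ L)
    there : ∀ {x L} → Repetition L → Repetition (x ∷ L)

  -- Each entry of A has a partner. A partner in B is removed together with its entry; as B is
  -- shorter, some partner must be found within A.
  Balanced-pigeonhole : ∀ A B → Balanced (A ++ B) → length B < length A → Repetition A
  Balanced-pigeonhole (a ∷ A) B b lt with ∈ₚ.∈-++⁻ wordSetoid A (Balanced-partner b)
  ... | inj₁ a∈A = here a∈A
  ... | inj₂ a∈B with B' , σ ← ∈⇒↭ a∈B =
    there (Balanced-pigeonhole A B' (Balanced-cancel (Balanced-resp-↭ τ b))
      (ℕₚ.≤-pred (subst (_< suc (length A)) (↭ₚ.xs↭ys⇒|xs|≡|ys| σ) lt)))
    where
    τ : a ∷ A ++ B ↭ a ∷ a ∷ A ++ B'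
    τ = ↭-prep a (↭-trans (↭ₚ.++⁺ˡ A σ) (↭ₚ.↭-shift A B'))

  -- The two deleted letters are located by the first of them, so that exchange can tell whether the
  -- leading letter takes part.
  data Shortenable : Word n → Set where
    here  : ∀ {s w w'} → Deletion w w' → s ∷ w ≈ w' → Shortenable (s ∷ w)
    there : ∀ {s w} → Shortenable w → Shortenable (s ∷ w)

  Repetition⇒Shortenable : ∀ w → Repetition (N w) → Shortenable w
  Repetition⇒Shortenable (s ∷ w) (here r∈) with w' , d , e ← ∈N⇒Deletion w r∈ =
    here d (~-trans (~-sym (++-conj w [ s ])) e)
  Repetition⇒Shortenable (s ∷ w) (there rep) = there (Repetition⇒Shortenable w rep)

  opaque
    -- N v is too short to pair off all of N u, so two positions of u carry the same reflection, and
    -- both letters can be deleted.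
    deletion : ∀ {u v} → u ≈ v → length v < length u → Shortenable u
    deletion {u} {v} e lt = Repetition⇒Shortenable u
      (Balanced-pigeonhole (N u) (N v) (N-invariant e)
        (≡.subst₂ _<_ (≡.sym (length-N v)) (≡.sym (length-N u)) lt))

  IsReflection : Word n → Set
  IsReflection t = ∃[ s ] InC M s t

  palindrome : Word n → Fin n → Word n
  palindrome x s = x ++ s ∷ [] ++ inv x

  palindrome-involution : ∀ x s → palindrome x s ++ palindrome x s ≈ []
  palindrome-involution x s = begin
    palindrome x s ++ palindrome x s         ≡⟨ Lₚ.++-assoc x (s ∷ inv x) _ ⟩
    x ++ s ∷ inv x ++ x ++ s ∷ inv x         ≈⟨ ++-congˡ x (∷-cong s (inv-inverseˡ x (s ∷ inv x))) ⟩
    x ++ s ∷ s ∷ inv x                       ≈⟨ ++-congˡ x (ss≈ s (inv x)) ⟩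
    x ++ inv x                               ≡⟨ cong (x ++_) (Lₚ.++-identityʳ (inv x)) ⟨
    x ++ inv x ++ []                         ≈⟨ inv-inverseʳ x [] ⟩
    []                                       ∎

  reflection-involution : ∀ {t} → IsReflection t → t ++ t ≈ []
  reflection-involution (s , x , e) = ~-trans (~-cong e e) (palindrome-involution x s)

  N-inv : ∀ w → N (inv w) ↭ map (conj (inv w)) (N w)
  N-inv [] = ↭-refl
  N-inv (s ∷ w) = R.begin
    N (inv (s ∷ w))                                    R.≡⟨ cong N (Lₚ.unfold-reverse s w) ⟩
    N (inv w ++ [ s ])                                 R.≡⟨ N-++ (inv w) [ s ] ⟩
    map (conj [ s ]) (N (inv w)) ++ [ [ s ] ]          R.↭⟨ ↭ₚ.++-comm _ [ [ s ] ] ⟩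
    [ s ] ∷ map (conj [ s ]) (N (inv w))               R.↭⟨ prep head (↭-trans (↭ₚ.map⁺ wordSetoid (conj-congʳ [ s ]) (N-inv w)) (↭-reflexive tail)) ⟩
    map (conj (inv (s ∷ w))) (N (s ∷ w))               R.∎
    where
    module R = PermutationReasoning
    head : [ s ] ≈ conj (inv (s ∷ w)) (conj w [ s ])
    head = ~-sym (begin
      conj (inv (s ∷ w)) (conj w [ s ])   ≡⟨ conj-∘ (inv (s ∷ w)) w [ s ] ⟩
      conj (w ++ inv (s ∷ w)) [ s ]       ≈⟨ conj-cong {r = [ s ]} (begin
         w ++ inv (s ∷ w)       ≡⟨ cong (w ++_) (Lₚ.unfold-reverse s w) ⟩
         w ++ inv w ++ [ s ]    ≈⟨ inv-inverseʳ w [ s ] ⟩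
         [ s ] ∎) ~-refl ⟩
      conj [ s ] [ s ]                    ≈⟨ conj-self [ s ] ⟩
      [ s ]                               ∎)
    tail : map (conj [ s ]) (map (conj (inv w)) (N w)) ≡ map (conj (inv (s ∷ w))) (N w)
    tail = ≡.trans (≡.sym (Lₚ.map-∘ (N w)))
      (Lₚ.map-cong (λ r → ≡.trans (conj-∘ [ s ] (inv w) r)
        (cong (λ z → conj z r) (≡.sym (Lₚ.unfold-reverse s w)))) (N w))

  -- Apart from its centre p, a palindrome p inverts pairs {r, prp}.
  N-palindrome : ∀ x s → let p = palindrome x s in
    ∃[ L ] N p ↭ p ∷ L ++ map (conj p) L
  N-palindrome x s = L , (R.begin
    N p                                                     R.≡⟨ N-++ x (s ∷ inv x) ⟩
    map (conj (s ∷ inv x)) (N x) ++ c ∷ N (inv x)           R.↭⟨ ↭ₚ.↭-shift _ _ ⟩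
    c ∷ map (conj (s ∷ inv x)) (N x) ++ N (inv x)           R.↭⟨ prep c≈p (↭-trans (↭ₚ.++⁺ˡ (map (conj (s ∷ inv x)) (N x)) (N-inv x)) (↭ₚ.++-comm (map (conj (s ∷ inv x)) (N x)) L)) ⟩
    p ∷ L ++ map (conj (s ∷ inv x)) (N x)                   R.↭⟨ ↭-prep p (↭ₚ.++⁺ˡ L (↭-trans (↭-reflexive-≋ (map-conj-cong (~-sym x⁻¹p) (N x))) (↭-reflexive L-conj))) ⟩
    p ∷ L ++ map (conj p) L                                 R.∎)
    where
    module R = PermutationReasoning
    p c : Word n
    p = palindrome x s
    c = conj (inv x) [ s ]
    L = map (conj (inv x)) (N x)
    c≈p : c ≈ p
    c≈p = ≈-reflexive (cong (_++ s ∷ inv x) (Lₚ.reverse-involutive x))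
    x⁻¹p : inv x ++ p ≈ s ∷ inv x
    x⁻¹p = inv-inverseˡ x (s ∷ inv x)
    L-conj : map (conj (inv x ++ p)) (N x) ≡ map (conj p) L
    L-conj = ≡.trans (Lₚ.map-cong (λ r → ≡.sym (conj-∘ p (inv x) r)) (N x)) (Lₚ.map-∘ (N x))

  ∈-map-conj-self : ∀ {p} L → p ++ p ≈ [] → p ∈ map (conj p) L → p ∈ L
  ∈-map-conj-self {p} L pp p∈cL with r , r∈L , e ← ∈ₚ.∈-map⁻ wordSetoid wordSetoid p∈cL =
    ∈ₚ.∈-resp-≈ wordSetoid (begin
      r                    ≈⟨ conj-involution p r pp ⟨
      conj p (conj p r)    ≈⟨ conj-congʳ p e ⟨
      conj p p             ≈⟨ conj-self p ⟩
      p                    ∎) r∈L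

  -- Conjugation by p fixes p, so p occurs equally often in L and in its image. These occurrences
  -- cancel, which leaves the partner of the leading p in K. The number k is the measure of the
  -- recursion.
  Balanced-fixed : ∀ p → p ++ p ≈ [] → ∀ k K L → length L ≡ k →
    Balanced (p ∷ K ++ L ++ map (conj p) L) → p ∈ K
  Balanced-fixed p pp k K L len b with ∈ₚ.∈-++⁻ wordSetoid K (Balanced-partner b)
  ... | inj₁ p∈K = p∈K
  ... | inj₂ p∈LL = remove k len
    where
    p∈L : p ∈ L
    p∈L = Sum.[ id , ∈-map-conj-self L pp ] (∈ₚ.∈-++⁻ wordSetoid L p∈LL)
    L' = proj₁ (∈⇒↭ p∈L)
    σ : L ↭ p ∷ L'
    σ = proj₂ (∈⇒↭ p∈L)
    cL = map (conj p) L
    cL' = map (conj p) L'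
    σ' : cL ↭ p ∷ cL'
    σ' = ↭-trans (↭ₚ.map⁺ wordSetoid (conj-congʳ p) σ) (prep (conj-self p) ↭-refl)
    -- Three copies of p: the leading one, one from L and one from its image. Two of them cancel,
    -- and the shape is kept with a shorter L.
    τ : p ∷ K ++ L ++ cL ↭ p ∷ p ∷ p ∷ K ++ L' ++ cL'
    τ = ↭-prep p (R.begin
      K ++ L ++ cL                  R.↭⟨ ↭ₚ.++⁺ˡ K (↭ₚ.++⁺ σ σ') ⟩
      K ++ p ∷ L' ++ p ∷ cL'        R.↭⟨ ↭ₚ.↭-shift K _ ⟩
      p ∷ K ++ L' ++ p ∷ cL'        R.↭⟨ ↭-prep p (↭ₚ.++⁺ˡ K (↭ₚ.↭-shift L' cL')) ⟩
      p ∷ K ++ p ∷ L' ++ cL'        R.↭⟨ ↭-prep p (↭ₚ.↭-shift K _) ⟩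
      p ∷ p ∷ K ++ L' ++ cL'        R.∎)
      where module R = PermutationReasoning
    remove : ∀ k → length L ≡ k → p ∈ K
    remove zero len0 with () ← ≡.trans (≡.sym (↭ₚ.xs↭ys⇒|xs|≡|ys| σ)) len0
    remove (suc k) len1 = Balanced-fixed p pp k K L'
      (ℕₚ.suc-injective (≡.trans (≡.sym (↭ₚ.xs↭ys⇒|xs|≡|ys| σ)) len1))
      (Balanced-cancel (Balanced-resp-↭ τ b))

  opaque
    -- In the sum of N p all terms but the centre p come in conjugate pairs, so p lies in N u or in
    -- pN(w)p, hence in N u or N w. The first is excluded: deleting a letter from u would spell w
    -- with fewer letters than u.
    strong-exchange : ∀ w {t} → IsReflection t → LenLt M (w ++ t) w → t ∈ N w
    strong-exchange w {t} (s , x , t≈p) (u , u≈wt , u<) =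
      ∈ₚ.∈-resp-≈ wordSetoid (~-sym t≈p) p∈Nw
      where
      p : Word n
      p = palindrome x s
      pp : p ++ p ≈ []
      pp = palindrome-involution x s
      u≈wp : u ≈ w ++ p
      u≈wp = ~-trans u≈wt (++-congˡ w t≈p)
      K : List (Word n)
      K = N u ++ map (conj p) (N w)
      p∈K : p ∈ K
      p∈K with L , σ ← N-palindrome x s =
        Balanced-fixed p pp (length L) K L refl (Balanced-resp-↭ (R.begin
          N u ++ N (w ++ p)                          R.≡⟨ cong (N u ++_) (N-++ w p) ⟩
          N u ++ map (conj p) (N w) ++ N p           R.≡⟨ Lₚ.++-assoc (N u) _ _ ⟨
          K ++ N p                                   R.↭⟨ ↭ₚ.++⁺ˡ K σ ⟩
          K ++ p ∷ L ++ map (conj p) L               R.↭⟨ ↭ₚ.↭-shift K _ ⟩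
          p ∷ K ++ L ++ map (conj p) L               R.∎) (N-invariant u≈wp))
        where module R = PermutationReasoning
      p∈Nw : p ∈ N w
      p∈Nw with ∈ₚ.∈-++⁻ wordSetoid (N u) p∈K
      ... | inj₂ p∈cN = ∈-map-conj-self (N w) pp p∈cN
      ... | inj₁ p∈Nu with u' , d , e ← ∈N⇒Deletion u p∈Nu =
        ⊥-elim (ℕₚ.<-asym (u< u' (begin
            u'              ≈⟨ e ⟨
            u ++ p          ≈⟨ ++-congʳ p u≈wp ⟩
            (w ++ p) ++ p   ≡⟨ Lₚ.++-assoc w p p ⟩
            w ++ p ++ p     ≈⟨ ++-congˡ w pp ⟩
            w ++ []         ≡⟨ Lₚ.++-identityʳ w ⟩
            w               ∎))
          (ℕₚ.≤-reflexive (≡.sym (Deletion-length d))))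

-- Tits' solution of the word problem

module WordProblem {n : ℕ} (M : CoxeterMatrix n) where
  open Reflections M
  open import Relation.Binary.Reasoning.Setoid wordSetoid

  Reduced : Word n → Set
  Reduced u = ∀ v → u ≈ v → length u ≤ length v

  Reduced-resp : ∀ {u v} → u ≈ v → length u ≡ length v → Reduced u → Reduced v
  Reduced-resp u≈v len red w v≈w = subst (_≤ length w) len (red w (~-trans u≈v v≈w))

  Shortenable⇒shorter : ∀ {w} → Shortenable w → ∃[ v ] (w ≈ v × length v < length w)
  Shortenable⇒shorter (here {w = w} {w'} d e) =
    w' , e , s≤s (ℕₚ.≤-trans (ℕₚ.n≤1+n _) (ℕₚ.≤-reflexive (≡.sym (Deletion-length d))))
  Shortenable⇒shorter (there {s} sh) with v , e , lt ← Shortenable⇒shorter sh =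
    s ∷ v , ∷-cong s e , s≤s lt

  opaque
    -- If the leading s took no part in the deletion, the reduced word `w` would itself be
    -- shortened.
    exchange : ∀ {s w v} → Reduced w → s ∷ w ≈ v → length v ≤ length w →
      ∃[ w' ] (Deletion w w' × s ∷ w ≈ w')
    exchange red e le with deletion e (s≤s le)
    ... | here d e' = _ , d , e'
    ... | there sh with v , w≈v , lt ← Shortenable⇒shorter sh = contradiction (red v w≈v) (ℕₚ.<⇒≱ lt)

  length-altFrom : ∀ (s t : Fin n) k → length (altFrom s t k) ≡ k
  length-altFrom s t zero = refl
  length-altFrom s t (suc k) = cong suc (length-altFrom t s k)

  braid : ∀ s t k → m M s t ≡ just k → altFrom s t k ≈ altFrom t s k
  braid s t k mst = ++-cancelʳ (inv (altFrom t s k)) (begin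
    altFrom s t k ++ inv (altFrom t s k)         ≡⟨ alt-altFrom s t k ⟨
    alt s t k                                    ≈⟨ ~-rel s t k mst ⟩
    []                                           ≈⟨ inv-inverseʳ (altFrom t s k) [] ⟨
    altFrom t s k ++ inv (altFrom t s k) ++ []   ≡⟨ cong (altFrom t s k ++_) (Lₚ.++-identityʳ _) ⟩
    altFrom t s k ++ inv (altFrom t s k)         ∎)

  Deletion-++ : ∀ u {v x} → Deletion (u ++ v) x →
    (∃[ u' ] (Deletion u u' × x ≡ u' ++ v)) ⊎ (∃[ v' ] (Deletion v v' × x ≡ u ++ v'))
  Deletion-++ [] d = inj₂ (_ , d , refl)
  Deletion-++ (s ∷ u) here = inj₁ (u , here , refl)
  Deletion-++ (s ∷ u) (there d) with Deletion-++ u d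
  ... | inj₁ (u' , d' , refl) = inj₁ (s ∷ u' , there d' , refl)
  ... | inj₂ (v' , d' , refl) = inj₂ (v' , d' , refl)

  Deletion-altFrom : ∀ a b k {x} → Deletion (altFrom a b k) x →
    ∃[ i ] ∃[ r ] (i < k × altFrom a b k ≡ altFrom a b (suc i) ++ r × x ≡ altFrom a b i ++ r)
  Deletion-altFrom a b (suc k) here = 0 , altFrom b a k , s≤s z≤n , refl , refl
  Deletion-altFrom a b (suc k) (there d) with i , r , i<k , p , refl ← Deletion-altFrom b a k d =
    suc i , r , s≤s i<k , cong (a ∷_) p , refl

  altFrom-snoc : ∀ (a b : Fin n) k → ∃[ c ] altFrom a b (suc k) ≡ altFrom a b k ++ [ c ]
  altFrom-snoc a b zero = a , refl
  altFrom-snoc a b (suc k) with c , p ← altFrom-snoc b a k = c , cong (a ∷_) p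

  opaque
    -- Cancel what follows the deleted letter, then move the last remaining letter to the other
    -- side. The outcome contradicts the order of ab as soon as i + 1 is below m(a,b).
    altFrom-deletion : ∀ a b k {x} → Deletion (altFrom a b k) x → altFrom b a (suc k) ≈ x →
      ∃[ i ] (i < k × altFrom b a (suc i) ≈ altFrom a b (suc i))
    altFrom-deletion a b k {x} d e
      with i , r , i<k , p , refl ← Deletion-altFrom a b k d
      with c , q ← altFrom-snoc a b i = i , i<k , (begin
        altFrom b a (suc i)                       ≡⟨ Lₚ.++-identityʳ _ ⟨
        altFrom b a (suc i) ++ []                 ≈⟨ ++-congˡ (altFrom b a (suc i)) (ss≈ c []) ⟨
        altFrom b a (suc i) ++ c ∷ [ c ]          ≡⟨ Lₚ.++-assoc (altFrom b a (suc i)) [ c ] [ c ] ⟨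
        (b ∷ altFrom a b i ++ [ c ]) ++ [ c ]     ≡⟨ cong (λ y → b ∷ y ++ [ c ]) q ⟨
        (b ∷ altFrom a b (suc i)) ++ [ c ]        ≈⟨ ++-congʳ [ c ] (++-cancelʳ r
           (~-trans (≈-reflexive (cong (b ∷_) (≡.sym p))) e)) ⟩
        altFrom a b i ++ [ c ]                    ≡⟨ q ⟨
        altFrom a b (suc i)                       ∎)

  -- The prefix is the longest element of the dihedral subgroup of a and b, split off with lengths
  -- adding; finiteness of m(a,b) is part of the claim.
  AlternatingPrefix : Fin n → Fin n → Word n → Set
  AlternatingPrefix a b u = ∃[ k ] ∃[ z ] (m M a b ≡ just k × u ≈ altFrom a b k ++ z × length u ≡ k + length z)

  AlternatingPrefix-sym : ∀ {a b u} → AlternatingPrefix b a u → AlternatingPrefix a b u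
  AlternatingPrefix-sym {a} {b} (k , z , mba , e , len) =
    k , z , ≡.trans (CoxeterMatrix.sym M a b) mba , ~-trans e (++-congʳ z (braid b a k mba)) , len

  length-altFrom-++ : ∀ (a b : Fin n) j z → length (altFrom a b j ++ z) ≡ j + length z
  length-altFrom-++ a b j z = ≡.trans (Lₚ.length-++ (altFrom a b j)) (cong (_+ length z) (length-altFrom a b j))

  -- If u has left descents a and b, every alternating prefix of length below m(a,b) can be
  -- extended on the left by the exchange condition.
  extendPrefix : ∀ l {a b u y} j z → length z ≡ l → a ≢ b → Reduced u →
    u ≈ altFrom a b (suc j) ++ z → length u ≡ suc j + length z →
    u ≈ b ∷ y → length u ≡ suc (length y) →
    (∀ k → m M a b ≡ just k → suc j ≤ k) → AlternatingPrefix a b u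
  extendPrefix l {a} {b} {u} {y} j z lz a≢b red u≈ lu u≈by luy j≤ = go (m M a b) refl
    where
    x = altFrom a b (suc j) ++ z
    lux : length u ≡ length x
    lux = ≡.trans lu (≡.sym (length-altFrom-++ a b (suc j) z))
    bx≈y : b ∷ x ≈ y
    bx≈y = ~-trans (∷-cong b (~-trans (~-sym u≈) u≈by)) (ss≈ b y)
    extend : (∀ k → m M a b ≡ just k → suc j < k) → AlternatingPrefix a b u
    extend j<
      with x' , d , e ← exchange (Reduced-resp u≈ lux red) bx≈y
             (ℕₚ.≤-trans (ℕₚ.n≤1+n _) (ℕₚ.≤-reflexive (≡.trans (≡.sym luy) lux)))
      with Deletion-++ (altFrom a b (suc j)) d
    -- A deletion inside the prefix would identify the two alternating words of length i + 1 ≤ j + 1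
    -- < m(a,b).
    ... | inj₁ (p , dp , refl) with i , i<j , q ← altFrom-deletion a b (suc j) dp (++-cancelʳ z e) =
      contradiction q (alternating-distinct M b a (suc i) (a≢b ∘ ≡.sym) (s≤s z≤n)
        (λ k mba → ℕₚ.≤-trans (s≤s i<j) (j< k (≡.trans (CoxeterMatrix.sym M a b) mba))))
    -- A deletion in z makes room for b in front; a and b then exchange roles, the old expression
    -- serving as the one that begins with a.
    ... | inj₂ (z' , dz , refl) = rec l lz
      where
      lzz' : length z ≡ suc (length z')
      lzz' = Deletion-length dz
      rec : ∀ l → length z ≡ l → AlternatingPrefix a b u
      rec zero lz0 with () ← ≡.trans (≡.sym lz0) lzz'
      rec (suc l') lzs = AlternatingPrefix-sym (extendPrefix l' {b} {a} {u} {altFrom b a j ++ z} (suc j) z'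
        (ℕₚ.suc-injective (≡.trans (≡.sym lzz') lzs)) (a≢b ∘ ≡.sym) red
        (~-trans u≈ (~-trans (~-sym (ss≈ b x)) (∷-cong b e)))
        (≡.trans lu (≡.trans (cong (suc j +_) lzz') (ℕₚ.+-suc (suc j) (length z'))))
        u≈ lux
        (λ k mba → j< k (≡.trans (CoxeterMatrix.sym M a b) mba)))
    go : ∀ μ → m M a b ≡ μ → AlternatingPrefix a b u
    go nothing mab = extend (λ k mk → case ≡.trans (≡.sym mab) mk of λ ())
    go (just k) mab with suc j ℕ.≟ k
    ... | yes refl = suc j , z , mab , u≈ , lu
    ... | no j≢k = extend (λ k' mk → subst (suc j <_) (just-injective (≡.trans (≡.sym mab) mk)) (ℕₚ.≤∧≢⇒< (j≤ k mab) j≢k))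

  opaque
    alternatingPrefix : ∀ {a b u v} → a ≢ b → Reduced (a ∷ u) → a ∷ u ≈ b ∷ v → length u ≡ length v →
      AlternatingPrefix a b (a ∷ u)
    alternatingPrefix {a} {b} {u} a≢b red e len = extendPrefix (length u) 0 u refl a≢b red ~-refl refl e (cong suc len)
      (λ k mk → ℕₚ.≤-trans (s≤s z≤n) (offdiag M a b a≢b k mk))

  anyDeletion? : ∀ w {P : Word n → Set} → (∀ w' → Deletion w w' → Dec (P w')) →
    Dec (∃[ w' ] (Deletion w w' × P w'))
  anyDeletion? [] P? = no λ { (_ , () , _) }
  anyDeletion? (s ∷ w) P? with P? w here
  ... | yes p = yes (w , here , p)
  ... | no ¬p with anyDeletion? w (λ w' d → P? (s ∷ w') (there d))
  ...   | yes (w' , d , p) = yes (s ∷ w' , there d , p)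
  ...   | no ¬q = no λ { (_ , here , p) → ¬p p ; (_ , there d , p) → ¬q (_ , d , p) }

  anyOfLength? : ∀ l {P : Word n → Set} → (∀ w → Dec (P w)) → Dec (∃[ w ] (length w ≡ l × P w))
  anyOfLength? zero P? with P? []
  ... | yes p = yes ([] , refl , p)
  ... | no ¬p = no λ { ([] , _ , p) → ¬p p }
  anyOfLength? (suc l) P? with Finₚ.any? (λ s → anyOfLength? l (λ w → P? (s ∷ w)))
  ... | yes (s , w , len , p) = yes (s ∷ w , cong suc len , p)
  ... | no ¬p = no λ { (s ∷ w , len , p) → ¬p (s , w , ℕₚ.suc-injective len , p) }

  Normalises : ℕ → Set
  Normalises L = ∀ w → length w ≤ L → ∃[ w' ] (w ≈ w' × Reduced w')

  Decides : ℕ → Set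
  Decides L = ∀ u v → length u ≤ L → length v ≤ L → Dec (u ≈ v)

  -- By exchange, s followed by a reduced w' fails to be reduced only if w' ≈ s v for a deletion v
  -- of w'. Both sides have the length of w', so the question is decidable at level L.
  normalises-suc : ∀ L → Normalises L → Decides L → Normalises (suc L)
  normalises-suc L nf dec [] _ = [] , ~-refl , λ _ _ → z≤n
  normalises-suc L nf dec (s ∷ w) (s≤s w≤L) with w' , w≈w' , red ← nf w w≤L
    with anyDeletion? w' {λ v → w' ≈ s ∷ v}
      (λ v d → let le = ℕₚ.≤-trans (red w (~-sym w≈w')) w≤L in
               dec w' (s ∷ v) le (subst (_≤ L) (Deletion-length d) le))
  ... | yes (v , d , w'≈sv) with v' , v≈v' , red' ← nf v (ℕₚ.≤-trans (ℕₚ.n≤1+n _)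
            (subst (_≤ L) (Deletion-length d) (ℕₚ.≤-trans (red w (~-sym w≈w')) w≤L))) =
    v' , (begin
      s ∷ w        ≈⟨ ∷-cong s (~-trans w≈w' w'≈sv) ⟩
      s ∷ s ∷ v    ≈⟨ ss≈ s v ⟩
      v            ≈⟨ v≈v' ⟩
      v'           ∎) , red'
  ... | no ¬d = s ∷ w' , ∷-cong s w≈w' , λ v e → ℕₚ.≮⇒≥ λ lt →
    let v' , d , e' = exchange red e (ℕₚ.≤-pred lt) in
    ¬d (v' , d , ~-trans (~-sym (ss≈ s w')) (∷-cong s e'))

  -- For distinct first letters, equality means that both words start with the longest element of
  -- the dihedral subgroup of s and t, followed by a common remainder of known length; there are
  -- finitely many candidates for it.
  decides-reduced : ∀ L → Decides L → ∀ u v → Reduced u → Reduced v →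
    length u ≤ suc L → length v ≤ suc L → Dec (u ≈ v)
  decides-reduced L dec u v ru rv lu lv with length u ℕ.≟ length v
  ... | no l≢ = no λ e → l≢ (ℕₚ.≤-antisym (ru v e) (rv u (~-sym e)))
  decides-reduced L dec [] [] ru rv lu lv | yes _ = yes ~-refl
  decides-reduced L dec (s ∷ u) (t ∷ v) ru rv (s≤s lu) (s≤s lv) | yes len with s Finₚ.≟ t
  ... | yes refl = map′ (∷-cong s) (∷-cancel s) (dec u v lu lv)
  ... | no s≢t = go (m M s t) refl
    where
    len' : length u ≡ length v
    len' = ℕₚ.suc-injective len
    go : ∀ μ → m M s t ≡ μ → Dec (s ∷ u ≈ t ∷ v)
    go nothing mst = no λ e → case ≡.trans (≡.sym mst) (proj₁ (proj₂ (proj₂ (alternatingPrefix s≢t ru e len')))) of λ ()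
    go (just zero) mst with () ← offdiag M s t s≢t 0 mst
    go (just (suc k)) mst = map′ to from (anyOfLength? (length u ∸ k) Q?)
      where
      Q : Word n → Set
      -- The equation of lengths rules out truncation in `∸` and keeps the compared words within the
      -- bound of `dec`.
      Q z = k + length z ≡ length u × u ≈ altFrom t s k ++ z × v ≈ altFrom s t k ++ z
      Q? : ∀ z → Dec (Q z)
      Q? z with k + length z ℕ.≟ length u
      ... | no ¬p = no (¬p ∘ proj₁)
      ... | yes p = map′ (λ { (a , b) → p , a , b }) proj₂
        (dec u (altFrom t s k ++ z) lu (bnd t s) ×-dec dec v (altFrom s t k ++ z) lv (bnd s t))
        where
        bnd : ∀ a b → length (altFrom a b k ++ z) ≤ L
        bnd a b = subst (_≤ L) (≡.sym (≡.trans (length-altFrom-++ a b k z) p)) lu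
      to : ∃[ z ] (length z ≡ length u ∸ k × Q z) → s ∷ u ≈ t ∷ v
      to (z , _ , _ , p , q) = begin
        s ∷ u                           ≈⟨ ∷-cong s p ⟩
        altFrom s t (suc k) ++ z        ≈⟨ ++-congʳ z (braid s t (suc k) mst) ⟩
        altFrom t s (suc k) ++ z        ≈⟨ ∷-cong t q ⟨
        t ∷ v                           ∎
      from : s ∷ u ≈ t ∷ v → ∃[ z ] (length z ≡ length u ∸ k × Q z)
      from e with k' , z , mst' , p , l ← alternatingPrefix s≢t ru e len'
        with refl ← just-injective (≡.trans (≡.sym mst) mst') =
        z , ≡.trans (≡.sym (ℕₚ.m+n∸m≡n k (length z))) (cong (_∸ k) (≡.sym (ℕₚ.suc-injective l))) ,
        ≡.sym (ℕₚ.suc-injective l) , ∷-cancel s p ,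
        ∷-cancel t (begin
          t ∷ v                           ≈⟨ e ⟨
          s ∷ u                           ≈⟨ p ⟩
          altFrom s t (suc k) ++ z        ≈⟨ ++-congʳ z (braid s t (suc k) mst) ⟩
          altFrom t s (suc k) ++ z        ∎)

  decides-suc : ∀ L → Normalises (suc L) → Decides L → Decides (suc L)
  decides-suc L nf dec u v lu lv
    with u' , u≈u' , ru ← nf u lu | v' , v≈v' , rv ← nf v lv =
    map′ (λ e → ~-trans u≈u' (~-trans e (~-sym v≈v'))) (λ e → ~-trans (~-sym u≈u') (~-trans e v≈v'))
      (decides-reduced L dec u' v' ru rv (ℕₚ.≤-trans (ru u (~-sym u≈u')) lu) (ℕₚ.≤-trans (rv v (~-sym v≈v')) lv))

  wordProblem : ∀ L → Normalises L × Decides L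
  wordProblem zero = (λ { [] _ → [] , ~-refl , λ _ _ → z≤n }) , (λ { [] [] _ _ → yes ~-refl })
  wordProblem (suc L) with nf , dec ← wordProblem L =
    normalises-suc L nf dec , decides-suc L (normalises-suc L nf dec) dec

  opaque
    normalise : ∀ w → ∃[ w' ] (w ≈ w' × Reduced w')
    normalise w = proj₁ (wordProblem (length w)) w ℕₚ.≤-refl

-- Descents of rw and niceness

module Niceness {n : ℕ} (M : CoxeterMatrix n) where
  open Reflections M
  open WordProblem M
  open import Relation.Binary.Reasoning.Setoid wordSetoid
  open import Data.List.Membership.Setoid wordSetoid using (_∈_)
  import Data.List.Membership.Setoid.Properties as ∈ₚ

  LenLt-resp : ∀ {u u' v v'} → u ≈ u' → v ≈ v' → LenLt M u v → LenLt M u' v'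
  LenLt-resp e f (x , x≈u , x<) = x , ~-trans x≈u e , λ y y≈v' → x< y (~-trans y≈v' (~-sym f))

  -- A reduced word for w is essential: in an arbitrary word a listed reflection may cancel against
  -- another, whereas deleting a letter of a reduced word yields a true descent.
  descent-cases : ∀ ρ w {t} → IsReflection t → LenLt M ((ρ ++ w) ++ t) (ρ ++ w) →
    (∃[ r ] (r ∈ N ρ × t ≈ conj w r)) ⊎ LenLt M (w ++ t) w
  descent-cases ρ w {t} refl-t lt with w' , w≈w' , red ← normalise w
    with ∈ₚ.∈-++⁻ wordSetoid (map (conj w') (N ρ)) (subst (t ∈_) (N-++ ρ w')
           (strong-exchange (ρ ++ w') refl-t
             (LenLt-resp (++-congʳ t (++-congˡ ρ w≈w')) (++-congˡ ρ w≈w') lt)))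
  ... | inj₁ t∈ with r , r∈ , e ← ∈ₚ.∈-map⁻ wordSetoid wordSetoid t∈ =
    inj₁ (r , r∈ , ~-trans e (conj-cong (~-sym w≈w') ~-refl))
  ... | inj₂ t∈ with v , d , e ← ∈N⇒Deletion w' t∈ =
    inj₂ (v , ~-trans (~-sym e) (++-congʳ t (~-sym w≈w')) , λ y y≈w →
      ℕₚ.≤-trans (ℕₚ.≤-reflexive (≡.sym (Deletion-length d))) (red y (~-sym (~-trans y≈w w≈w'))))

  -- A reflection of A separates rw from w only if it is conjugate under w to an inversion of r.
  nice-criterion : ∀ (A : Pred n) → (∀ {u v} → u ≈ v → A u → A v) → (∀ {t} → A t → IsReflection t) →
    (∀ r w t → A r → ¬ A (conj w r) → A t → ∃[ ρ ] (r ≈ ρ × (∀ {r'} → r' ∈ N ρ → ¬ t ≈ conj w r'))) →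
    Nice M A
  nice-criterion A resp refls sep r w Ar ¬Ar t = mk⇔ (forward w ¬Ar) backward
    where
    forward : ∀ w → ¬ A (conj w r) → InD M A (r ++ w) t → InD M A w t
    forward w ¬Ar (At , lt) with ρ , r≈ρ , out ← sep r w t Ar ¬Ar At
      with descent-cases ρ w (refls At) (LenLt-resp (++-congʳ t (++-congʳ w r≈ρ)) (++-congʳ w r≈ρ) lt)
    ... | inj₁ (r' , r'∈ , e) = contradiction e (out r'∈)
    ... | inj₂ lt' = At , lt'
    w≈rrw : w ≈ r ++ r ++ w
    w≈rrw = begin
      w               ≈⟨ ++-congʳ w (reflection-involution (refls Ar)) ⟨
      (r ++ r) ++ w   ≡⟨ Lₚ.++-assoc r r w ⟩
      r ++ r ++ w     ∎
    backward : InD M A w t → InD M A (r ++ w) t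
    -- Replacing w by rw exchanges the two sides, because r² = 1, and leaves w⁻¹rw unchanged.
    backward (At , lt) = forward (r ++ w)
      (λ a → ¬Ar (resp (begin
        conj (r ++ w) r      ≡⟨ conj-∘ w r r ⟨
        conj w (conj r r)    ≈⟨ conj-congʳ w (conj-self r) ⟩
        conj w r             ∎) a))
      (At , LenLt-resp (++-congʳ t w≈rrw) w≈rrw lt)

  separated-simple : ∀ {A : Pred n} → (∀ {u v} → u ≈ v → A u → A v) → ∀ {r} w {t s} → r ≈ [ s ] →
    ¬ A (conj w r) → A t → ∃[ ρ ] (r ≈ ρ × (∀ {r'} → r' ∈ N ρ → ¬ t ≈ conj w r'))
  separated-simple resp w {s = s} r≈s ¬Ar At = [ s ] , r≈s , λ
    { (here e) t≈ → ¬Ar (resp (~-trans t≈ (conj-congʳ w (~-trans e (~-sym r≈s)))) At) }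

  simple-reflection : ∀ {s u} → u ≈ [ s ] → IsReflection u
  simple-reflection {s} e = s , [] , e

  InC-conj : ∀ {s r} w → InC M s r → InC M s (conj w r)
  InC-conj {s} {r} w (x , e) = inv w ++ x , ~-trans (conj-congʳ w e) (≈-reflexive
    (≡.trans (cong (inv w ++_) (Lₚ.++-assoc x (s ∷ inv x) w))
    (≡.trans (≡.sym (Lₚ.++-assoc (inv w) x (s ∷ inv x ++ w)))
      (cong (λ y → (inv w ++ x) ++ s ∷ y)
        (≡.sym (≡.trans (Lₚ.reverse-++ (inv w) x) (cong (inv x ++_) (Lₚ.reverse-involutive w))))))))

  cond1⇒nice : ∀ A → Cond1 M A → Nice M A
  cond1⇒nice A (S₁ , S₂ , A⇔) = nice-criterion A resp refls sep
    where
    module A⇔ u = Equivalence (A⇔ u)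
    resp : ∀ {u v} → u ≈ v → A u → A v
    resp {u} {v} e a with A⇔.to u a
    ... | inj₁ (s , s∈ , u≈) = A⇔.from v (inj₁ (s , s∈ , ~-trans (~-sym e) u≈))
    ... | inj₂ (s , s∈ , x , u≈) = A⇔.from v (inj₂ (s , s∈ , x , ~-trans (~-sym e) u≈))
    refls : ∀ {t} → A t → IsReflection t
    refls {t} a with A⇔.to t a
    ... | inj₁ (s , _ , e) = simple-reflection e
    ... | inj₂ (s , _ , c) = s , c
    sep : ∀ r w t → A r → ¬ A (conj w r) → A t → ∃[ ρ ] (r ≈ ρ × (∀ {r'} → r' ∈ N ρ → ¬ t ≈ conj w r'))
    sep r w t Ar ¬Ar At with A⇔.to r Ar
    ... | inj₁ (s , _ , r≈s) = separated-simple resp w r≈s ¬Ar At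
    ... | inj₂ (s , s∈ , c) = contradiction (A⇔.from (conj w r) (inj₂ (s , s∈ , InC-conj w c))) ¬Ar

  -- Dihedral groups with m(s,t) even or infinite

  module Dihedral {s t : Fin n} (s≢t : s ≢ t) (S≡st : ∀ i → i ≡ s ⊎ i ≡ t)
    (even : m M s t ≡ nothing ⊎ ∃[ k ] m M s t ≡ just (2 * k)) where

    sts ststs : Word n
    sts = s ∷ t ∷ s ∷ []
    ststs = s ∷ t ∷ s ∷ t ∷ s ∷ []

    odd : Word n → Bool
    odd [] = false
    odd (u ∷ w) = does (u Finₚ.≟ t) xor odd w

    odd-++ : ∀ u v → odd (u ++ v) ≡ odd u xor odd v
    odd-++ [] v = refl
    odd-++ (x ∷ u) v = ≡.trans (cong (does (x Finₚ.≟ t) xor_) (odd-++ u v))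
      (≡.sym (𝔹ₚ.xor-assoc (does (x Finₚ.≟ t)) (odd u) (odd v)))

    even-entry : ∀ i j k → i ≢ j → m M i j ≡ just k → ∃[ h ] k ≡ h + h
    even-entry i j k i≢j mij = halve even
      where
      mst : m M s t ≡ just k
      mst with S≡st i | S≡st j
      ... | inj₁ refl | inj₁ refl = contradiction refl i≢j
      ... | inj₁ refl | inj₂ refl = mij
      ... | inj₂ refl | inj₁ refl = ≡.trans (CoxeterMatrix.sym M s t) mij
      ... | inj₂ refl | inj₂ refl = contradiction refl i≢j
      halve : m M s t ≡ nothing ⊎ ∃[ k ] m M s t ≡ just (2 * k) → ∃[ h ] k ≡ h + h
      halve (inj₁ ∞) = case ≡.trans (≡.sym ∞) mst of λ ()
      halve (inj₂ (h , e)) = h , ≡.trans (just-injective (≡.trans (≡.sym mst) e)) (cong (h +_) (ℕₚ.+-identityʳ h))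

    -- Here evenness of m(s,t) enters: the relator then consists of two equal halves.
    odd-invariant : ∀ {u v} → u ≈ v → odd u ≡ odd v
    odd-invariant ~-refl = refl
    odd-invariant (~-sym e) = ≡.sym (odd-invariant e)
    odd-invariant (~-trans e f) = ≡.trans (odd-invariant e) (odd-invariant f)
    odd-invariant (~-cong {u} {u'} {v} {v'} e f) =
      ≡.trans (odd-++ u v) (≡.trans (cong₂ _xor_ (odd-invariant e) (odd-invariant f)) (≡.sym (odd-++ u' v')))
    odd-invariant (~-rel i j k mij) with i Finₚ.≟ j
    ... | yes refl with refl ← just-injective (≡.trans (≡.sym mij) (diag M i)) =
      ≡.trans (≡.sym (𝔹ₚ.xor-assoc b b false)) (cong (_xor false) (𝔹ₚ.xor-same b))
      where b = does (i Finₚ.≟ t)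
    odd-invariant (~-rel i j k mij) | no i≢j with h , refl ← even-entry i j k i≢j mij =
      ≡.trans (cong odd (alt-+ i j h h)) (≡.trans (odd-++ (alt i j h) (alt i j h)) (𝔹ₚ.xor-same (odd (alt i j h))))

    odd-conj : ∀ w r → odd (conj w r) ≡ odd r
    odd-conj w r = lem (odd w) (odd (conj w r)) (odd r)
      (≡.trans (≡.sym (odd-++ w (conj w r))) (≡.trans (odd-invariant (++-conj w r)) (odd-++ r w)))
      where
      lem : ∀ a x y → a xor x ≡ y xor a → x ≡ y
      lem false x y p = ≡.trans p (𝔹ₚ.xor-identityʳ y)
      lem true true true p = refl
      lem true false false p = refl

    χs : does (s Finₚ.≟ t) ≡ false
    χs = dec-false (s Finₚ.≟ t) s≢t

    χt : does (t Finₚ.≟ t) ≡ true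
    χt = dec-true (t Finₚ.≟ t) refl

    odd-t : odd [ t ] ≡ true
    odd-t rewrite χt = refl

    odd-s : odd [ s ] ≡ false
    odd-s rewrite χs = refl

    odd-sts : odd sts ≡ true
    odd-sts rewrite χs | χt = refl

    odd-ststs : odd ststs ≡ false
    odd-ststs rewrite χs | χt = refl

    odd-separates : ∀ {u x} w r → odd x ≡ true → odd r ≡ false → u ≈ x → ¬ u ≈ conj w r
    odd-separates w r ox or u≈x u≈ = case ≡.trans (≡.sym ox) (≡.trans
      (odd-invariant (~-trans (~-sym u≈x) u≈)) (≡.trans (odd-conj w r) or)) of λ ()

    -- Stands for "c is a rotation". Instead of an exponent of st it records the property used
    -- below, that conjugation by either generator inverts c.
    Inverted : Word n → Set
    Inverted c = s ∷ c ≈ inv c ++ [ s ] × t ∷ c ≈ inv c ++ [ t ]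

    inverted-inv : ∀ a c → a ∷ c ≈ inv c ++ [ a ] → a ∷ inv c ≈ c ++ [ a ]
    inverted-inv a c e = ++-cancelʳ [ a ] (begin
      a ∷ inv c ++ [ a ]          ≈⟨ ∷-cong a e ⟨
      a ∷ a ∷ c                   ≈⟨ ss≈ a c ⟩
      c                           ≡⟨ Lₚ.++-identityʳ c ⟨
      c ++ []                     ≈⟨ ++-congˡ c (ss≈ a []) ⟨
      c ++ a ∷ a ∷ []             ≡⟨ Lₚ.++-assoc c [ a ] [ a ] ⟨
      (c ++ [ a ]) ++ [ a ]       ∎)

    inv-∷∷ : ∀ (a b : Fin n) c v → inv (a ∷ b ∷ c) ++ v ≡ inv c ++ b ∷ a ∷ v
    inv-∷∷ a b c v = ≡.trans (inv-∷ a (b ∷ c) v) (inv-∷ b c (a ∷ v))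

    rotate₁ : ∀ a b c → b ∷ c ≈ inv c ++ [ b ] → a ∷ a ∷ b ∷ c ≈ inv (a ∷ b ∷ c) ++ [ a ]
    rotate₁ a b c e = begin
      a ∷ a ∷ b ∷ c               ≈⟨ ss≈ a (b ∷ c) ⟩
      b ∷ c                       ≈⟨ e ⟩
      inv c ++ [ b ]              ≈⟨ ++-congˡ (inv c) (∷-cong b (ss≈ a [])) ⟨
      inv c ++ b ∷ a ∷ a ∷ []     ≡⟨ inv-∷∷ a b c [ a ] ⟨
      inv (a ∷ b ∷ c) ++ [ a ]    ∎

    rotate₂ : ∀ a b c → a ∷ c ≈ inv c ++ [ a ] → b ∷ c ≈ inv c ++ [ b ] →
      b ∷ a ∷ b ∷ c ≈ inv (a ∷ b ∷ c) ++ [ b ]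
    rotate₂ a b c ea eb = begin
      b ∷ a ∷ b ∷ c                  ≈⟨ ∷-cong b (∷-cong a eb) ⟩
      b ∷ a ∷ inv c ++ [ b ]         ≈⟨ ∷-cong b (++-congʳ [ b ] (inverted-inv a c ea)) ⟩
      b ∷ (c ++ [ a ]) ++ [ b ]      ≡⟨ cong (b ∷_) (Lₚ.++-assoc c [ a ] [ b ]) ⟩
      (b ∷ c) ++ a ∷ b ∷ []          ≈⟨ ++-congʳ (a ∷ b ∷ []) eb ⟩
      (inv c ++ [ b ]) ++ a ∷ b ∷ [] ≡⟨ Lₚ.++-assoc (inv c) [ b ] _ ⟩
      inv c ++ b ∷ a ∷ b ∷ []        ≡⟨ inv-∷∷ a b c [ b ] ⟨
      inv (a ∷ b ∷ c) ++ [ b ]       ∎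

    rotation-or-reflection : ∀ z → ∃[ c ] (Inverted c × (z ≈ c ⊎ z ≈ s ∷ c))
    rotation-or-reflection [] = [] , (~-refl , ~-refl) , inj₁ ~-refl
    rotation-or-reflection (x ∷ z) with S≡st x | rotation-or-reflection z
    ... | inj₁ refl | c , ic , inj₁ e = c , ic , inj₂ (∷-cong s e)
    ... | inj₁ refl | c , ic , inj₂ e = c , ic , inj₁ (~-trans (∷-cong s e) (ss≈ s c))
    ... | inj₂ refl | c , (es , et) , inj₁ e = s ∷ t ∷ c , (rotate₁ s t c et , rotate₂ s t c es et) ,
      inj₂ (~-trans (∷-cong t e) (~-sym (ss≈ s (t ∷ c))))
    ... | inj₂ refl | c , (es , et) , inj₂ e = t ∷ s ∷ c , (rotate₂ t s c et es , rotate₁ t s c es) ,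
      inj₁ (∷-cong t e)

    -- A rotation commuting with s is its own inverse, hence central.
    rotation-square : ∀ c → s ∷ c ≈ inv c ++ [ s ] → conj c [ s ] ≈ [ s ] → ∀ v → inv c ++ inv c ++ v ≈ v
    rotation-square c es cs v = begin
      inv c ++ inv c ++ v                      ≈⟨ ++-congˡ (inv c) (++-congˡ (inv c) (ss≈ s v)) ⟨
      inv c ++ inv c ++ s ∷ s ∷ v              ≡⟨ cong (inv c ++_) (Lₚ.++-assoc (inv c) [ s ] (s ∷ v)) ⟨
      inv c ++ (inv c ++ [ s ]) ++ s ∷ v       ≈⟨ ++-congˡ (inv c) (++-congʳ (s ∷ v) es) ⟨
      inv c ++ s ∷ c ++ s ∷ v                  ≡⟨ Lₚ.++-assoc (inv c) (s ∷ c) (s ∷ v) ⟨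
      conj c [ s ] ++ s ∷ v                    ≈⟨ ++-congʳ (s ∷ v) cs ⟩
      s ∷ s ∷ v                                ≈⟨ ss≈ s v ⟩
      v                                        ∎

    conj-∷-self : ∀ w → conj (s ∷ w) [ s ] ≈ conj w [ s ]
    conj-∷-self w = begin
      conj (s ∷ w) [ s ]          ≡⟨ conj-∘ w [ s ] [ s ] ⟨
      conj w (conj [ s ] [ s ])   ≈⟨ conj-congʳ w (conj-self [ s ]) ⟩
      conj w [ s ]                ∎

    -- Write z as c or sc with c a rotation. In both cases c commutes with s, so it is central of
    -- square 1, and t is carried to t or to sts.
    centralizer : ∀ z → conj z [ s ] ≈ [ s ] → conj z [ t ] ≈ [ t ] ⊎ conj z [ t ] ≈ sts
    centralizer z zs with rotation-or-reflection z
    ... | c , (es , et) , inj₁ e = inj₁ (begin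
        conj z [ t ]                 ≈⟨ conj-cong {r = [ t ]} e ~-refl ⟩
        conj c [ t ]                 ≈⟨ ++-congˡ (inv c) et ⟩
        inv c ++ inv c ++ [ t ]      ≈⟨ rotation-square c es (~-trans (conj-cong {r = [ s ]} (~-sym e) ~-refl) zs) [ t ] ⟩
        [ t ]                        ∎)
    ... | c , (es , et) , inj₂ e = inj₂ (begin
        conj z [ t ]                               ≈⟨ conj-cong {r = [ t ]} e ~-refl ⟩
        conj (s ∷ c) [ t ]                         ≡⟨ inv-∷ s c (t ∷ s ∷ c) ⟩
        inv c ++ s ∷ t ∷ s ∷ c                     ≈⟨ ++-congˡ (inv c) (∷-cong s (∷-cong t es)) ⟩
        inv c ++ s ∷ t ∷ inv c ++ [ s ]            ≈⟨ ++-congˡ (inv c) (∷-cong s (++-congʳ [ s ] (inverted-inv t c et))) ⟩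
        inv c ++ s ∷ (c ++ [ t ]) ++ [ s ]         ≡⟨ cong (λ x → inv c ++ s ∷ x) (Lₚ.++-assoc c [ t ] [ s ]) ⟩
        inv c ++ (s ∷ c) ++ t ∷ s ∷ []             ≈⟨ ++-congˡ (inv c) (++-congʳ (t ∷ s ∷ []) es) ⟩
        inv c ++ (inv c ++ [ s ]) ++ t ∷ s ∷ []    ≡⟨ cong (inv c ++_) (Lₚ.++-assoc (inv c) [ s ] _) ⟩
        inv c ++ inv c ++ sts                      ≈⟨ rotation-square c es
          (~-trans (~-sym (conj-∷-self c)) (~-trans (conj-cong {r = [ s ]} (~-sym e) ~-refl) zs)) sts ⟩
        sts                                        ∎)

    -- Treats both sets at once: s may or may not belong to A, and the centralizer argument delivers
    -- t or sts.
    module _ (A : Pred n) (resp : ∀ {u v} → u ≈ v → A u → A v)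
      (A⊆ : ∀ {u} → A u → u ≈ [ s ] ⊎ u ≈ [ t ] ⊎ u ≈ sts)
      (t∈A : A [ t ]) (sts∈A : A sts) where

      A⇒reflection : ∀ {u} → A u → IsReflection u
      A⇒reflection a with A⊆ a
      ... | inj₁ e = simple-reflection e
      ... | inj₂ (inj₁ e) = simple-reflection e
      ... | inj₂ (inj₂ e) = t , [ s ] , e

      commuting-conj : ∀ w z → conj z [ t ] ≈ conj w sts → conj z [ s ] ≈ [ s ] → A (conj w sts)
      commuting-conj w z e zs with centralizer z zs
      ... | inj₁ zt = resp (~-trans (~-sym zt) e) t∈A
      ... | inj₂ zt = resp (~-trans (~-sym zt) e) sts∈A

      separated-sts : ∀ {w x} → ¬ A (conj w sts) → A x → ∀ {r'} → r' ∈ N sts → ¬ x ≈ conj w r'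
      separated-sts {w} ¬A Ax (there (here e)) x≈ = ¬A (resp (~-trans x≈ (conj-congʳ w e)) Ax)
      separated-sts {w} {x} ¬A Ax (here e) x≈ with A⊆ Ax
      ... | inj₂ (inj₁ x≈t) = odd-separates w ststs odd-t odd-ststs x≈t (~-trans x≈ (conj-congʳ w e))
      ... | inj₂ (inj₂ x≈sts) = odd-separates w ststs odd-sts odd-ststs x≈sts (~-trans x≈ (conj-congʳ w e))
      -- With z = tsw one has z⁻¹tz = w⁻¹(sts)w and z⁻¹sz = w⁻¹(ststs)w, which is x and hence s.
      ... | inj₁ x≈s = ¬A (commuting-conj w (t ∷ s ∷ w)
        (begin
          conj (t ∷ s ∷ w) [ t ]             ≡⟨ conj-∘ w (t ∷ s ∷ []) [ t ] ⟨
          conj w (s ∷ t ∷ t ∷ t ∷ s ∷ [])    ≈⟨ conj-congʳ w (∷-cong s (ss≈ t (t ∷ s ∷ []))) ⟩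
          conj w sts                         ∎)
        (begin
          conj (t ∷ s ∷ w) [ s ]    ≡⟨ conj-∘ w (t ∷ s ∷ []) [ s ] ⟨
          conj w ststs              ≈⟨ ~-trans x≈ (conj-congʳ w e) ⟨
          x                         ≈⟨ x≈s ⟩
          [ s ]                     ∎))
      separated-sts {w} {x} ¬A Ax (there (there (here e))) x≈ with A⊆ Ax
      ... | inj₂ (inj₁ x≈t) = odd-separates w [ s ] odd-t odd-s x≈t (~-trans x≈ (conj-congʳ w e))
      ... | inj₂ (inj₂ x≈sts) = odd-separates w [ s ] odd-sts odd-s x≈sts (~-trans x≈ (conj-congʳ w e))
      -- Here z = sw: again z⁻¹tz = w⁻¹(sts)w, and z⁻¹sz = w⁻¹sw is x, hence s.
      ... | inj₁ x≈s = ¬A (commuting-conj w (s ∷ w)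
        (≈-reflexive (≡.sym (conj-∘ w [ s ] [ t ])))
        (begin
          conj (s ∷ w) [ s ]    ≈⟨ conj-∷-self w ⟩
          conj w [ s ]          ≈⟨ ~-trans x≈ (conj-congʳ w e) ⟨
          x                     ≈⟨ x≈s ⟩
          [ s ]                 ∎))

      dihedral⇒nice : Nice M A
      dihedral⇒nice = nice-criterion A resp A⇒reflection separated
        where
        separated : ∀ r w x → A r → ¬ A (conj w r) → A x →
          ∃[ ρ ] (r ≈ ρ × (∀ {r'} → r' ∈ N ρ → ¬ x ≈ conj w r'))
        separated r w x Ar ¬Ar Ax with A⊆ Ar
        ... | inj₁ e = separated-simple resp w e ¬Ar Ax
        ... | inj₂ (inj₁ e) = separated-simple resp w e ¬Ar Ax
        ... | inj₂ (inj₂ e) = sts , e , separated-sts (¬Ar ∘ resp (conj-congʳ w (~-sym e))) Ax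

  cond2⇒nice : ∀ A → Cond2 M A → Nice M A
  cond2⇒nice A (s , t , s≢t , S≡st , even , inj₁ A⇔) =
    dihedral⇒nice A resp (A⇔.to _) (A⇔.from _ (inj₂ (inj₁ ~-refl))) (A⇔.from _ (inj₂ (inj₂ ~-refl)))
    where
    open Dihedral s≢t S≡st even
    module A⇔ u = Equivalence (A⇔ u)
    resp : ∀ {u v} → u ≈ v → A u → A v
    resp {u} {v} e a with A⇔.to u a
    ... | inj₁ f = A⇔.from v (inj₁ (~-trans (~-sym e) f))
    ... | inj₂ (inj₁ f) = A⇔.from v (inj₂ (inj₁ (~-trans (~-sym e) f)))
    ... | inj₂ (inj₂ f) = A⇔.from v (inj₂ (inj₂ (~-trans (~-sym e) f)))
  cond2⇒nice A (s , t , s≢t , S≡st , even , inj₂ A⇔) =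
    dihedral⇒nice A resp (inj₂ ∘ A⇔.to _) (A⇔.from _ (inj₁ ~-refl)) (A⇔.from _ (inj₂ ~-refl))
    where
    open Dihedral s≢t S≡st even
    module A⇔ u = Equivalence (A⇔ u)
    resp : ∀ {u v} → u ≈ v → A u → A v
    resp {u} {v} e a with A⇔.to u a
    ... | inj₁ f = A⇔.from v (inj₁ (~-trans (~-sym e) f))
    ... | inj₂ f = A⇔.from v (inj₂ (~-trans (~-sym e) f))

theorem1p16 : ∀ (n : ℕ) (M : CoxeterMatrix n) (A : Pred n) →
    Cond1 M A ⊎ Cond2 M A → Nice M A
theorem1p16 n M A (inj₁ c) = Niceness.cond1⇒nice M A c
theorem1p16 n M A (inj₂ c) = Niceness.cond2⇒nice M A c
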